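{- Let $0<q<1$, let $n$ be a nonnegative integer, let $k$ be an integer with $0\le k\le n$, and let $x\in[0,1]$. Then $$B_{n-k,n}(1-x,q)=B_{k,n}(x,q),$$ and $$\sum_{k=0}^n B_{k,n}(x,q)=\bigl(1+[x]_q[1-x]_q(1-q)\bigr)^n=B_{n,q}(1:x),$$ where $B_{n,q}(1:x)$ denotes the modified $q$-Bernstein operator applied to the constant function $1$.
   Context: Let $q$ be a real number with $0<q<1$. For real $x$, the $q$-number is $[x]_q=\frac{1-q^x}{1-q}$. For a nonnegative integer $k$ and $x\in[0,1]$, the modified $q$-Bernstein polynomials $B_{k,n}(x,q)$, $n=0,1,2,\dots$, are defined by the generating function $$\frac{t^k e^{[1-x]_q t}[x]_q^k}{k!}=\sum_{n=0}^\infty B_{k,n}(x,q)\frac{t^n}{n!}.$$ For $f$ continuous on $[0,1]$, the modified $q$-Bernstein operator is $B_{n,q}(f:x)=\sum_{j=0}^n f\left(\frac{j}{n}\right)B_{j,n}(x,q)$ for $x\in[0,1]$. -}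

module Defs where

open import Algebra.Bundles using (CommutativeRing; Semiring)
import Algebra.Definitions.RawSemiring as RawSemiringDefs
open import Data.Bool.Base using (if_then_else_)
open import Data.Fin.Base using (Fin; toℕ)
import Data.Fin.Properties as Fin
open import Data.Integer.Base as ℤ using (+_)
import Data.Integer.Properties as ℤ
open import Data.Nat.Base as ℕ using (ℕ; zero; suc; _∸_; _!)
import Data.Nat.Properties as ℕ
open import Data.Product.Base using (∃; _×_; _,_; proj₁; proj₂)
open import Data.Rational.Base as ℚ using (ℚ; 0ℚ; 1ℚ; ½)
import Data.Rational.Base
import Data.Rational.Properties as ℚ
open import Data.Rational.Solver using (module +-*-Solver)
import Data.Rational.Unnormalised.Base as ℚᵘ
import Data.Rational.Unnormalised.Properties as ℚᵘ
open import Data.Sum.Base using (inj₁; inj₂)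
open import Level using (0ℓ)
open import Relation.Binary.PropositionalEquality using (_≡_; _≢_; refl; sym; trans; cong; cong₂; subst; subst₂)
open import Relation.Nullary.Decidable using (yes; no)
open import Relation.Nullary.Negation using (contradiction)

module RationalLemmas where

  open Data.Rational.Base using (_+_; _*_; -_; _-_; ∣_∣; _≤_; _<_; _/_; positive; nonNegative)
  open RawSemiringDefs ℚ.+-*-rawSemiring using (_^_)
  open +-*-Solver using (solve; _:+_; _:*_; _:-_; :-_; _:=_; con)
  open ℚ.≤-Reasoning

  IsCauchy : (ℕ → ℚ) → Set
  IsCauchy s = ∀ ε → 0ℚ < ε → ∃ λ N → ∀ m n → N ℕ.≤ m → N ℕ.≤ n → ∣ s m - s n ∣ ≤ ε

  ∑< : ℕ → (ℕ → ℚ) → ℚ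
  ∑< zero    f = 0ℚ
  ∑< (suc n) f = ∑< n f + f n

  fromℕ : ℕ → ℚ
  fromℕ n = + n / 1

  -- The value at 0 is junk.
  recip : ℚ → ℚ
  recip p with p ℚ.≟ 0ℚ
  ... | yes _  = 0ℚ
  ... | no p≢0 = ℚ.1/_ p {{ℚ.≢-nonZero p≢0}}

  *-recip : ∀ {p} → p ≢ 0ℚ → p * recip p ≡ 1ℚ
  *-recip {p} p≢0 with p ℚ.≟ 0ℚ
  ... | yes p≡0 = contradiction p≡0 p≢0
  ... | no p≢0′ = ℚ.*-inverseʳ p {{ℚ.≢-nonZero p≢0′}}

  0<⇒≢0 : ∀ {p} → 0ℚ < p → p ≢ 0ℚ
  0<⇒≢0 0<p refl = ℚ.<-irrefl refl 0<p

  0≤1 : 0ℚ ≤ 1ℚ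
  0≤1 = ℚ.nonNegative⁻¹ 1ℚ

  0<1 : 0ℚ < 1ℚ
  0<1 = ℚ.positive⁻¹ 1ℚ

  0<½ : 0ℚ < ½
  0<½ = ℚ.positive⁻¹ ½

  *-monoˡ-≤ : ∀ {p q} r → 0ℚ ≤ r → p ≤ q → r * p ≤ r * q
  *-monoˡ-≤ r 0≤r = ℚ.*-monoˡ-≤-nonNeg r {{nonNegative 0≤r}}

  *-monoʳ-≤ : ∀ {p q} r → 0ℚ ≤ r → p ≤ q → p * r ≤ q * r
  *-monoʳ-≤ r 0≤r = ℚ.*-monoʳ-≤-nonNeg r {{nonNegative 0≤r}}

  *-mono-≤ : ∀ {p q r s} → 0ℚ ≤ p → 0ℚ ≤ s → p ≤ q → r ≤ s → p * r ≤ q * s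
  *-mono-≤ {p} {q} {r} {s} 0≤p 0≤s p≤q r≤s =
    ℚ.≤-trans (*-monoˡ-≤ p 0≤p r≤s) (*-monoʳ-≤ s 0≤s p≤q)

  0≤* : ∀ {p q} → 0ℚ ≤ p → 0ℚ ≤ q → 0ℚ ≤ p * q
  0≤* {p} {q} 0≤p 0≤q = subst (_≤ p * q) (ℚ.*-zeroʳ p) (*-monoˡ-≤ p 0≤p 0≤q)

  0<* : ∀ {p q} → 0ℚ < p → 0ℚ < q → 0ℚ < p * q
  0<* {p} {q} 0<p 0<q =
    subst (_< p * q) (ℚ.*-zeroʳ p) (ℚ.*-monoʳ-<-pos p {{positive 0<p}} 0<q)

  0≤+ : ∀ {p q} → 0ℚ ≤ p → 0ℚ ≤ q → 0ℚ ≤ p + q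
  0≤+ = ℚ.+-mono-≤

  ≤+ : ∀ {p q} → 0ℚ ≤ q → p ≤ p + q
  ≤+ {p} {q} 0≤q = subst (_≤ p + q) (ℚ.+-identityʳ p) (ℚ.+-monoʳ-≤ p 0≤q)

  ≤⇒0≤- : ∀ {p q} → p ≤ q → 0ℚ ≤ q - p
  ≤⇒0≤- {p} {q} p≤q = subst (_≤ q - p) (ℚ.+-inverseʳ p) (ℚ.+-monoˡ-≤ (- p) p≤q)

  <⇒0<- : ∀ {p q} → p < q → 0ℚ < q - p
  <⇒0<- {p} {q} p<q = subst (_< q - p) (ℚ.+-inverseʳ p) (ℚ.+-monoˡ-< (- p) p<q)

  0≤-⇒≤ : ∀ {p q} → 0ℚ ≤ q - p → p ≤ q
  0≤-⇒≤ {p} {q} h = subst₂ _≤_ (ℚ.+-identityˡ p)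
    (solve 2 (λ a b → (a :- b) :+ b := a) refl q p) (ℚ.+-monoˡ-≤ p h)

  0<recip : ∀ {p} → 0ℚ < p → 0ℚ < recip p
  0<recip {p} 0<p = ℚ.*-cancelˡ-<-nonNeg p {{nonNegative (ℚ.<⇒≤ 0<p)}}
    (subst₂ _<_ (sym (ℚ.*-zeroʳ p)) (sym (*-recip (0<⇒≢0 0<p))) 0<1)

  half+half : ∀ ε → ε * ½ + ε * ½ ≡ ε
  half+half ε = trans (sym (ℚ.*-distribˡ-+ ε ½ ½)) (ℚ.*-identityʳ ε)

  ∣p-q∣≡∣q-p∣ : ∀ p q → ∣ p - q ∣ ≡ ∣ q - p ∣
  ∣p-q∣≡∣q-p∣ p q = trans (sym (ℚ.∣-p∣≡∣p∣ (p - q)))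
    (cong ∣_∣ (solve 2 (λ a b → :- (a :- b) := b :- a) refl p q))

  p≤∣p∣ : ∀ p → p ≤ ∣ p ∣
  p≤∣p∣ p with ℚ.≤-total 0ℚ p
  ... | inj₁ 0≤p = ℚ.≤-reflexive (sym (ℚ.0≤p⇒∣p∣≡p 0≤p))
  ... | inj₂ p≤0 = ℚ.≤-trans p≤0 (ℚ.0≤∣p∣ p)

  ∣p∣≤ : ∀ {p r} → p ≤ r → - p ≤ r → ∣ p ∣ ≤ r
  ∣p∣≤ {p} {r} p≤r -p≤r with ℚ.∣p∣≡p∨∣p∣≡-p p
  ... | inj₁ e = subst (_≤ r) (sym e) p≤r
  ... | inj₂ e = subst (_≤ r) (sym e) -p≤r

  triangle : ∀ p q r → ∣ p - r ∣ ≤ ∣ p - q ∣ + ∣ q - r ∣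
  triangle p q r = subst (λ z → ∣ z ∣ ≤ ∣ p - q ∣ + ∣ q - r ∣)
    (solve 3 (λ a b c → (a :- b) :+ (b :- c) := a :- c) refl p q r)
    (ℚ.∣p+q∣≤∣p∣+∣q∣ (p - q) (q - r))

  ∣∣p∣-∣q∣∣≤ : ∀ p q → ∣ ∣ p ∣ - ∣ q ∣ ∣ ≤ ∣ p - q ∣
  ∣∣p∣-∣q∣∣≤ p q = ∣p∣≤ (half p q)
    (subst₂ _≤_ (solve 2 (λ a b → b :- a := :- (a :- b)) refl ∣ p ∣ ∣ q ∣) (∣p-q∣≡∣q-p∣ q p) (half q p))
    where
    half : ∀ p q → ∣ p ∣ - ∣ q ∣ ≤ ∣ p - q ∣
    half p q = subst₂ _≤_
      (cong (λ z → ∣ z ∣ - ∣ q ∣) (solve 2 (λ a b → (a :- b) :+ b := a) refl p q))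
      (solve 2 (λ a b → (a :+ b) :- b := a) refl ∣ p - q ∣ ∣ q ∣)
      (ℚ.+-monoˡ-≤ (- ∣ q ∣) (ℚ.∣p+q∣≤∣p∣+∣q∣ (p - q) q))

  +-distance : ∀ p q r s → ∣ (p + q) - (r + s) ∣ ≤ ∣ p - r ∣ + ∣ q - s ∣
  +-distance p q r s = subst (λ z → ∣ z ∣ ≤ ∣ p - r ∣ + ∣ q - s ∣)
    (solve 4 (λ a b c d → (a :- c) :+ (b :- d) := (a :+ b) :- (c :+ d)) refl p q r s)
    (ℚ.∣p+q∣≤∣p∣+∣q∣ (p - r) (q - s))

  *-distance : ∀ p q r s → ∣ p * q - r * s ∣ ≤ ∣ p ∣ * ∣ q - s ∣ + ∣ s ∣ * ∣ p - r ∣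
  *-distance p q r s = begin
    ∣ p * q - r * s ∣
      ≡⟨ cong ∣_∣ (solve 4 (λ a b c d → a :* b :- c :* d := a :* (b :- d) :+ d :* (a :- c)) refl p q r s) ⟩
    ∣ p * (q - s) + s * (p - r) ∣
      ≤⟨ ℚ.∣p+q∣≤∣p∣+∣q∣ (p * (q - s)) (s * (p - r)) ⟩
    ∣ p * (q - s) ∣ + ∣ s * (p - r) ∣
      ≡⟨ cong₂ _+_ (ℚ.∣p*q∣≡∣p∣*∣q∣ p (q - s)) (ℚ.∣p*q∣≡∣p∣*∣q∣ s (p - r)) ⟩
    ∣ p ∣ * ∣ q - s ∣ + ∣ s ∣ * ∣ p - r ∣ ∎

  neg-distance : ∀ p q → ∣ - p - - q ∣ ≡ ∣ p - q ∣
  neg-distance p q = trans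
    (cong ∣_∣ (solve 2 (λ a b → (:- a) :- (:- b) := b :- a) refl p q)) (∣p-q∣≡∣q-p∣ q p)

  shrink : ℚ → ℚ → ℚ
  shrink K ε = recip K * ε

  0<shrink : ∀ {K ε} → 0ℚ < K → 0ℚ < ε → 0ℚ < shrink K ε
  0<shrink 0<K 0<ε = 0<* (0<recip 0<K) 0<ε

  *-shrink : ∀ {K} ε → 0ℚ < K → K * shrink K ε ≡ ε
  *-shrink {K} ε 0<K = trans (sym (ℚ.*-assoc K (recip K) ε))
    (trans (cong (_* ε) (*-recip (0<⇒≢0 0<K))) (ℚ.*-identityˡ ε))

  0<half : ∀ {ε} → 0ℚ < ε → 0ℚ < ε * ½
  0<half 0<ε = 0<* 0<ε 0<½

  toℚᵘ-fromℕ : ∀ n → ℚ.toℚᵘ (fromℕ n) ℚᵘ.≃ ℚᵘ.mkℚᵘ (+ n) 0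
  toℚᵘ-fromℕ n = ℚ.toℚᵘ-fromℚᵘ (ℚᵘ.mkℚᵘ (+ n) 0)

  fromℕ-suc : ∀ n → fromℕ (suc n) ≡ 1ℚ + fromℕ n
  fromℕ-suc n = ℚ.toℚᵘ-injective (ℚᵘ.≃-trans (toℚᵘ-fromℕ (suc n)) (ℚᵘ.≃-sym
    (ℚᵘ.≃-trans (ℚ.toℚᵘ-homo-+ 1ℚ (fromℕ n))
    (ℚᵘ.≃-trans (ℚᵘ.+-congʳ (ℚ.toℚᵘ 1ℚ) (toℚᵘ-fromℕ n))
      (ℚᵘ.*≡* (cong (ℤ._* + 1) (cong (ℤ._+_ (+ 1)) (ℤ.*-identityʳ (+ n)))))))))

  0≤fromℕ : ∀ n → 0ℚ ≤ fromℕ n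
  0≤fromℕ zero    = ℚ.≤-refl
  0≤fromℕ (suc n) = subst (0ℚ ≤_) (sym (fromℕ-suc n)) (0≤+ 0≤1 (0≤fromℕ n))

  fromℕ-mono : ∀ {m n} → m ℕ.≤ n → fromℕ m ≤ fromℕ n
  fromℕ-mono {n = n} ℕ.z≤n = 0≤fromℕ n
  fromℕ-mono (ℕ.s≤s {m} {n} m≤n) = subst₂ _≤_ (sym (fromℕ-suc m)) (sym (fromℕ-suc n))
    (ℚ.+-monoʳ-≤ 1ℚ (fromℕ-mono m≤n))

  archimedean : ∀ p q → 0ℚ < q → ∃ λ j → p ≤ fromℕ j * q
  archimedean p@(ℚ.mkℚ n d _) q@(ℚ.mkℚ ℤ.+[1+ m ] e _) 0<q = j , ℚ.toℚᵘ-cancel-≤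
    (ℚᵘ.≤-respʳ-≃ (ℚᵘ.≃-sym (ℚᵘ.≃-trans (ℚ.toℚᵘ-homo-* (fromℕ j) q)
                               (ℚᵘ.*-congʳ {ℚ.toℚᵘ q} (toℚᵘ-fromℕ j))))
      (ℚᵘ.*≤* bound))
    where
    j = ℤ.∣ n ∣ ℕ.* suc e
    natBound : ℤ.∣ n ∣ ℕ.* (1 ℕ.* suc e) ℕ.≤ (j ℕ.* suc m) ℕ.* suc d
    natBound = ℕ.≤-trans
      (ℕ.≤-reflexive (cong (ℤ.∣ n ∣ ℕ.*_) (ℕ.*-identityˡ (suc e))))
      (ℕ.≤-trans (ℕ.m≤m*n j (suc m)) (ℕ.m≤m*n (j ℕ.* suc m) (suc d)))
    i≤∣i∣ : ∀ i → i ℤ.≤ + ℤ.∣ i ∣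
    i≤∣i∣ (+ k)       = ℤ.≤-refl
    i≤∣i∣ ℤ.-[1+ k ] = ℤ.-≤+
    bound : n ℤ.* + (1 ℕ.* suc e) ℤ.≤ (+ j ℤ.* ℤ.+[1+ m ]) ℤ.* + suc d
    bound = ℤ.≤-trans (ℤ.*-monoʳ-≤-nonNeg (+ (1 ℕ.* suc e)) (i≤∣i∣ n))
      (subst₂ ℤ._≤_ (ℤ.pos-* ℤ.∣ n ∣ (1 ℕ.* suc e))
        (trans (ℤ.pos-* (j ℕ.* suc m) (suc d)) (cong (ℤ._* + suc d) (ℤ.pos-* j (suc m))))
        (ℤ.+≤+ natBound))
  archimedean p (ℚ.mkℚ (+ 0) e _) (ℚ.*<* (ℤ.+<+ ()))
  archimedean p (ℚ.mkℚ ℤ.-[1+ m ] e _) (ℚ.*<* ())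

  1/ℕ : (n : ℕ) .{{_ : ℕ.NonZero n}} → ℚ
  1/ℕ n = + 1 / n

  1/ℕ-* : ∀ m n .{{_ : ℕ.NonZero m}} .{{_ : ℕ.NonZero n}} .{{_ : ℕ.NonZero (m ℕ.* n)}} →
          1/ℕ (m ℕ.* n) ≡ 1/ℕ m * 1/ℕ n
  1/ℕ-* (suc m) (suc n) = ℚ.toℚᵘ-injective (ℚᵘ.≃-trans
    (ℚ.toℚᵘ-fromℚᵘ (ℚᵘ.mkℚᵘ (+ 1) (n ℕ.+ m ℕ.* suc n)))
    (ℚᵘ.≃-sym (ℚᵘ.≃-trans (ℚ.toℚᵘ-homo-* (1/ℕ (suc m)) (1/ℕ (suc n)))
      (ℚᵘ.≃-trans (ℚᵘ.*-cong (ℚ.toℚᵘ-fromℚᵘ (ℚᵘ.mkℚᵘ (+ 1) m)) (ℚ.toℚᵘ-fromℚᵘ (ℚᵘ.mkℚᵘ (+ 1) n)))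
        ℚᵘ.≃-refl))))

  fromℕ*1/ℕ : ∀ n .{{_ : ℕ.NonZero n}} → fromℕ n * 1/ℕ n ≡ 1ℚ
  fromℕ*1/ℕ (suc n) = ℚ.toℚᵘ-injective
    (ℚᵘ.≃-trans (ℚ.toℚᵘ-homo-* (fromℕ (suc n)) (1/ℕ (suc n)))
    (ℚᵘ.≃-trans (ℚᵘ.*-cong (toℚᵘ-fromℕ (suc n)) (ℚ.toℚᵘ-fromℚᵘ (ℚᵘ.mkℚᵘ (+ 1) n)))
      (ℚᵘ.*≡* (cong (λ k → + k) (trans (ℕ.*-identityʳ _) (trans (ℕ.*-identityʳ _)
        (sym (trans (ℕ.*-identityˡ _) (ℕ.*-identityˡ _)))))))))

  0<1/ℕ : ∀ n .{{_ : ℕ.NonZero n}} → 0ℚ < 1/ℕ n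
  0<1/ℕ n = ℚ.positive⁻¹ (1/ℕ n) {{ℚ.normalize-pos 1 n}}

  1/! : ℕ → ℚ
  1/! n = 1/ℕ (n !) {{ℕ._!≢0 n}}

  1/!-suc : ∀ n → 1/! (suc n) ≡ 1/ℕ (suc n) * 1/! n
  1/!-suc n = split (suc n !) (n !) refl {{ℕ._!≢0 (suc n)}} {{ℕ._!≢0 n}}
    where
    split : ∀ k l → k ≡ suc n ℕ.* l → .{{_ : ℕ.NonZero k}} .{{_ : ℕ.NonZero l}} →
            1/ℕ k ≡ 1/ℕ (suc n) * 1/ℕ l
    split _ l refl = 1/ℕ-* (suc n) l

  0≤1/! : ∀ n → 0ℚ ≤ 1/! n
  0≤1/! n = ℚ.<⇒≤ (0<1/ℕ (n !) {{ℕ._!≢0 n}})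

  0≤^ : ∀ {r} → 0ℚ ≤ r → ∀ i → 0ℚ ≤ r ^ i
  0≤^ 0≤r zero    = 0≤1
  0≤^ 0≤r (suc i) = 0≤* 0≤r (0≤^ 0≤r i)

  ∣^∣≤ : ∀ {p r} → ∣ p ∣ ≤ r → ∀ i → ∣ p ^ i ∣ ≤ r ^ i
  ∣^∣≤ _ zero = ℚ.≤-refl
  ∣^∣≤ {p} {r} ∣p∣≤r (suc i) = subst (_≤ r ^ suc i) (sym (ℚ.∣p*q∣≡∣p∣*∣q∣ p (p ^ i)))
    (*-mono-≤ (ℚ.0≤∣p∣ p) (0≤^ (ℚ.≤-trans (ℚ.0≤∣p∣ p) ∣p∣≤r) i) ∣p∣≤r (∣^∣≤ ∣p∣≤r i))

  ^-lipschitz : ∀ {p q r} → ∣ p ∣ ≤ r → ∣ q ∣ ≤ r → ∀ i →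
                ∣ p ^ suc i - q ^ suc i ∣ ≤ (fromℕ (suc i) * r ^ i) * ∣ p - q ∣
  ^-lipschitz {p} {q} {r} hp hq zero = ℚ.≤-reflexive (trans
    (cong ∣_∣ (cong₂ _-_ (ℚ.*-identityʳ p) (ℚ.*-identityʳ q))) (sym (ℚ.*-identityˡ ∣ p - q ∣)))
  ^-lipschitz {p} {q} {r} hp hq (suc i) = begin
    ∣ p * p ^ suc i - q * q ^ suc i ∣
      ≤⟨ *-distance p (p ^ suc i) q (q ^ suc i) ⟩
    ∣ p ∣ * ∣ p ^ suc i - q ^ suc i ∣ + ∣ q ^ suc i ∣ * D
      ≤⟨ ℚ.+-mono-≤
           (*-mono-≤ (ℚ.0≤∣p∣ p) (0≤* (0≤* (0≤fromℕ (suc i)) (0≤^ 0≤r i)) (ℚ.0≤∣p∣ (p - q))) hp (^-lipschitz hp hq i))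
           (*-monoʳ-≤ D (ℚ.0≤∣p∣ (p - q)) (∣^∣≤ hq (suc i))) ⟩
    r * ((fromℕ (suc i) * r ^ i) * D) + (r * r ^ i) * D
      ≡⟨ solve 4 (λ a b c d → a :* ((b :* c) :* d) :+ (a :* c) :* d := ((con 1ℚ :+ b) :* (a :* c)) :* d) refl r (fromℕ (suc i)) (r ^ i) D ⟩
    ((1ℚ + fromℕ (suc i)) * (r * r ^ i)) * D
      ≡⟨ cong (λ z → (z * (r * r ^ i)) * D) (sym (fromℕ-suc (suc i))) ⟩
    (fromℕ (suc (suc i)) * r ^ suc i) * D ∎
    where
    D = ∣ p - q ∣
    0≤r = ℚ.≤-trans (ℚ.0≤∣p∣ p) hp

  ∑-distance : ∀ f g M D → (∀ i → ∣ f i - g i ∣ ≤ M i * D) →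
               ∀ n → ∣ ∑< n f - ∑< n g ∣ ≤ ∑< n M * D
  ∑-distance f g M D h zero    = ℚ.≤-reflexive (sym (ℚ.*-zeroˡ D))
  ∑-distance f g M D h (suc n) = ℚ.≤-trans (+-distance (∑< n f) (f n) (∑< n g) (g n))
    (subst (_ ≤_) (sym (ℚ.*-distribʳ-+ D (∑< n M) (M n)))
      (ℚ.+-mono-≤ (∑-distance f g M D h n) (h n)))

  ∑-tail : ∀ f M → (∀ i → ∣ f i ∣ ≤ M i) →
           ∀ n k → ∣ ∑< (k ℕ.+ n) f - ∑< n f ∣ ≤ ∑< (k ℕ.+ n) M - ∑< n M
  ∑-tail f M h n zero = ℚ.≤-reflexive (trans (cong ∣_∣ (ℚ.+-inverseʳ (∑< n f))) (sym (ℚ.+-inverseʳ (∑< n M))))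
  ∑-tail f M h n (suc k) = begin
    ∣ (F + f (k ℕ.+ n)) - ∑< n f ∣
      ≡⟨ cong ∣_∣ (solve 3 (λ a b c → (a :+ b) :- c := (a :- c) :+ b) refl F (f (k ℕ.+ n)) (∑< n f)) ⟩
    ∣ (F - ∑< n f) + f (k ℕ.+ n) ∣
      ≤⟨ ℚ.∣p+q∣≤∣p∣+∣q∣ (F - ∑< n f) (f (k ℕ.+ n)) ⟩
    ∣ F - ∑< n f ∣ + ∣ f (k ℕ.+ n) ∣
      ≤⟨ ℚ.+-mono-≤ (∑-tail f M h n k) (h (k ℕ.+ n)) ⟩
    (G - ∑< n M) + M (k ℕ.+ n)
      ≡⟨ solve 3 (λ a b c → (a :- c) :+ b := (a :+ b) :- c) refl G (M (k ℕ.+ n)) (∑< n M) ⟩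
    (G + M (k ℕ.+ n)) - ∑< n M ∎
    where
    F = ∑< (k ℕ.+ n) f
    G = ∑< (k ℕ.+ n) M

  ∑-tail′ : ∀ f M → (∀ i → ∣ f i ∣ ≤ M i) →
            ∀ m n → ∣ ∑< m f - ∑< n f ∣ ≤ ∣ ∑< m M - ∑< n M ∣
  ∑-tail′ f M h m n with ℕ.≤-total n m
  ... | inj₁ n≤m = subst (λ j → ∣ ∑< j f - ∑< n f ∣ ≤ ∣ ∑< j M - ∑< n M ∣) (ℕ.m∸n+n≡m n≤m)
                     (ℚ.≤-trans (∑-tail f M h n (m ∸ n)) (p≤∣p∣ _))
  ... | inj₂ m≤n = subst₂ _≤_ (∣p-q∣≡∣q-p∣ (∑< n f) (∑< m f)) (∣p-q∣≡∣q-p∣ (∑< n M) (∑< m M))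
                     (subst (λ j → ∣ ∑< j f - ∑< m f ∣ ≤ ∣ ∑< j M - ∑< m M ∣) (ℕ.m∸n+n≡m m≤n)
                       (ℚ.≤-trans (∑-tail f M h m (n ∸ m)) (p≤∣p∣ _)))

  Cauchy⇒bounded : ∀ {s} → IsCauchy s →
                   ∃ λ K → 0ℚ < K × ∃ λ N → ∀ n → N ℕ.≤ n → ∣ s n ∣ ≤ K
  Cauchy⇒bounded {s} c with c 1ℚ 0<1
  ... | N , h = ∣ s N ∣ + 1ℚ , ℚ.+-mono-≤-< (ℚ.0≤∣p∣ (s N)) 0<1 , N , λ n N≤n → begin
    ∣ s n ∣                      ≡⟨ cong ∣_∣ (solve 2 (λ a b → a := b :+ (a :- b)) refl (s n) (s N)) ⟩
    ∣ s N + (s n - s N) ∣        ≤⟨ ℚ.∣p+q∣≤∣p∣+∣q∣ (s N) (s n - s N) ⟩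
    ∣ s N ∣ + ∣ s n - s N ∣      ≤⟨ ℚ.+-monoʳ-≤ ∣ s N ∣ (h n N N≤n ℕ.≤-refl) ⟩
    ∣ s N ∣ + 1ℚ                 ∎

  Cauchy-* : ∀ {s} → IsCauchy s → ∀ {K} → 0ℚ < K → ∀ ε → 0ℚ < ε →
             ∃ λ N → ∀ m n → N ℕ.≤ m → N ℕ.≤ n → K * ∣ s m - s n ∣ ≤ ε
  Cauchy-* c {K} 0<K ε 0<ε with c (shrink K ε) (0<shrink 0<K 0<ε)
  ... | N , h = N , λ m n N≤m N≤n →
    subst (_ ≤_) (*-shrink ε 0<K) (*-monoˡ-≤ K (ℚ.<⇒≤ 0<K) (h m n N≤m N≤n))

  ≤-half : ∀ {p q ε} → p ≤ ε * ½ → q ≤ ε * ½ → p + q ≤ ε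
  ≤-half {p} {q} {ε} hp hq = subst (p + q ≤_) (half+half ε) (ℚ.+-mono-≤ hp hq)

  l⊔ : ∀ m n {o} → m ℕ.⊔ n ℕ.≤ o → m ℕ.≤ o
  l⊔ m n = ℕ.≤-trans (ℕ.m≤m⊔n m n)

  r⊔ : ∀ m n {o} → m ℕ.⊔ n ℕ.≤ o → n ℕ.≤ o
  r⊔ m n = ℕ.≤-trans (ℕ.m≤n⊔m m n)

  const-cauchy : ∀ p → IsCauchy (λ _ → p)
  const-cauchy p ε 0<ε = 0 , λ _ _ _ _ →
    subst (_≤ ε) (sym (cong ∣_∣ (ℚ.+-inverseʳ p))) (ℚ.<⇒≤ 0<ε)

  +-cauchy : ∀ {s t} → IsCauchy s → IsCauchy t → IsCauchy (λ n → s n + t n)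
  +-cauchy {s} {t} cs ct ε 0<ε with cs (ε * ½) (0<half 0<ε) | ct (ε * ½) (0<half 0<ε)
  ... | N , h | N′ , h′ = N ℕ.⊔ N′ , λ m n Nm Nn → ℚ.≤-trans
    (+-distance (s m) (t m) (s n) (t n))
    (≤-half (h m n (l⊔ N N′ Nm) (l⊔ N N′ Nn)) (h′ m n (r⊔ N N′ Nm) (r⊔ N N′ Nn)))

  neg-cauchy : ∀ {s} → IsCauchy s → IsCauchy (λ n → - s n)
  neg-cauchy {s} c ε 0<ε with c ε 0<ε
  ... | N , h = N , λ m n Nm Nn → subst (_≤ ε) (sym (neg-distance (s m) (s n))) (h m n Nm Nn)

  abs-cauchy : ∀ {s} → IsCauchy s → IsCauchy (λ n → ∣ s n ∣)
  abs-cauchy {s} c ε 0<ε with c ε 0<ε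
  ... | N , h = N , λ m n Nm Nn → ℚ.≤-trans (∣∣p∣-∣q∣∣≤ (s m) (s n)) (h m n Nm Nn)

  *-cauchy : ∀ {s t} → IsCauchy s → IsCauchy t → IsCauchy (λ n → s n * t n)
  *-cauchy {s} {t} cs ct ε 0<ε = go (Cauchy⇒bounded {s} cs) (Cauchy⇒bounded {t} ct)
    where
    go : (∃ λ K → 0ℚ < K × ∃ λ N → ∀ n → N ℕ.≤ n → ∣ s n ∣ ≤ K) →
         (∃ λ L → 0ℚ < L × ∃ λ N → ∀ n → N ℕ.≤ n → ∣ t n ∣ ≤ L) →
         ∃ λ N → ∀ m n → N ℕ.≤ m → N ℕ.≤ n → ∣ s m * t m - s n * t n ∣ ≤ ε
    go (K , 0<K , N₁ , b₁) (L , 0<L , N₂ , b₂) = N₅ ℕ.⊔ N₆ , λ m n Nm Nn → ℚ.≤-trans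
      (*-distance (s m) (t m) (s n) (t n))
      (≤-half
        (ℚ.≤-trans (*-monoʳ-≤ ∣ t m - t n ∣ (ℚ.0≤∣p∣ (t m - t n)) (b₁ m (l⊔ N₁ N₃ (l⊔ N₅ N₆ Nm))))
          (proj₂ ht m n (r⊔ N₁ N₃ (l⊔ N₅ N₆ Nm)) (r⊔ N₁ N₃ (l⊔ N₅ N₆ Nn))))
        (ℚ.≤-trans (*-monoʳ-≤ ∣ s m - s n ∣ (ℚ.0≤∣p∣ (s m - s n)) (b₂ n (l⊔ N₂ N₄ (r⊔ N₅ N₆ Nn))))
          (proj₂ hs m n (r⊔ N₂ N₄ (r⊔ N₅ N₆ Nm)) (r⊔ N₂ N₄ (r⊔ N₅ N₆ Nn)))))
      where
      ht = Cauchy-* {t} ct 0<K (ε * ½) (0<half 0<ε)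
      hs = Cauchy-* {s} cs 0<L (ε * ½) (0<half 0<ε)
      N₃ = proj₁ ht
      N₄ = proj₁ hs
      N₅ = N₁ ℕ.⊔ N₃
      N₆ = N₂ ℕ.⊔ N₄

  recip-cauchy : ∀ {s δ N} → 0ℚ < δ → (∀ n → N ℕ.≤ n → δ ≤ s n) → IsCauchy s →
                 IsCauchy (λ n → recip (s n))
  recip-cauchy {s} {δ} {N} 0<δ lower c ε 0<ε = N ℕ.⊔ N′ , λ m n Nm Nn → begin
    ∣ recip (s m) - recip (s n) ∣
      ≡⟨ cong ∣_∣ (difference m n (l⊔ N N′ Nm) (l⊔ N N′ Nn)) ⟩
    ∣ (recip (s m) * recip (s n)) * (s n - s m) ∣
      ≡⟨ ℚ.∣p*q∣≡∣p∣*∣q∣ (recip (s m) * recip (s n)) (s n - s m) ⟩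
    ∣ recip (s m) * recip (s n) ∣ * ∣ s n - s m ∣
      ≡⟨ cong₂ _*_ (ℚ.0≤p⇒∣p∣≡p (0≤* (0≤recip m (l⊔ N N′ Nm)) (0≤recip n (l⊔ N N′ Nn)))) (∣p-q∣≡∣q-p∣ (s n) (s m)) ⟩
    (recip (s m) * recip (s n)) * ∣ s m - s n ∣
      ≤⟨ *-monoʳ-≤ ∣ s m - s n ∣ (ℚ.0≤∣p∣ (s m - s n))
           (*-mono-≤ (0≤recip m (l⊔ N N′ Nm)) (ℚ.<⇒≤ (0<recip 0<δ)) (upper m (l⊔ N N′ Nm)) (upper n (l⊔ N N′ Nn))) ⟩
    (recip δ * recip δ) * ∣ s m - s n ∣
      ≤⟨ proj₂ h m n (r⊔ N N′ Nm) (r⊔ N N′ Nn) ⟩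
    ε ∎
    where
    h = Cauchy-* {s} c (0<* (0<recip 0<δ) (0<recip 0<δ)) ε 0<ε
    N′ = proj₁ h
    0<s : ∀ n → N ℕ.≤ n → 0ℚ < s n
    0<s n Nn = ℚ.<-≤-trans 0<δ (lower n Nn)
    inverse : ∀ n → N ℕ.≤ n → s n * recip (s n) ≡ 1ℚ
    inverse n Nn = *-recip (0<⇒≢0 (0<s n Nn))
    0≤recip : ∀ n → N ℕ.≤ n → 0ℚ ≤ recip (s n)
    0≤recip n Nn = ℚ.<⇒≤ (0<recip (0<s n Nn))
    upper : ∀ n → N ℕ.≤ n → recip (s n) ≤ recip δ
    upper n Nn = begin
      recip (s n)                 ≡⟨ sym (ℚ.*-identityˡ (recip (s n))) ⟩
      1ℚ * recip (s n)            ≡⟨ cong (_* recip (s n)) (sym (*-recip (0<⇒≢0 0<δ))) ⟩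
      (δ * recip δ) * recip (s n) ≤⟨ *-monoʳ-≤ (recip (s n)) (0≤recip n Nn) (*-monoʳ-≤ (recip δ) (ℚ.<⇒≤ (0<recip 0<δ)) (lower n Nn)) ⟩
      (s n * recip δ) * recip (s n) ≡⟨ solve 3 (λ a b c → (a :* b) :* c := b :* (a :* c)) refl (s n) (recip δ) (recip (s n)) ⟩
      recip δ * (s n * recip (s n)) ≡⟨ cong (recip δ *_) (inverse n Nn) ⟩
      recip δ * 1ℚ                ≡⟨ ℚ.*-identityʳ (recip δ) ⟩
      recip δ                     ∎
    difference : ∀ m n → N ℕ.≤ m → N ℕ.≤ n →
                 recip (s m) - recip (s n) ≡ (recip (s m) * recip (s n)) * (s n - s m)
    difference m n Nm Nn = trans
      (cong₂ _-_
        (trans (sym (ℚ.*-identityʳ (recip (s m)))) (cong (recip (s m) *_) (sym (inverse n Nn))))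
        (trans (sym (ℚ.*-identityʳ (recip (s n)))) (cong (recip (s n) *_) (sym (inverse m Nm)))))
      (solve 4 (λ a b c d → (a :* (d :* b)) :- (b :* (c :* a)) := (a :* b) :* (d :- c)) refl
        (recip (s m)) (recip (s n)) (s m) (s n))

  module RatioTest (t : ℕ → ℚ) (0≤t : ∀ i → 0ℚ ≤ t i) (ρ : ℚ) (0≤ρ : 0ℚ ≤ ρ) (ρ<1 : ρ < 1ℚ)
                   (N : ℕ) (ratio : ∀ i → N ℕ.≤ i → t (suc i) ≤ ρ * t i) where

    δ : ℚ
    δ = 1ℚ - ρ

    0<δ : 0ℚ < δ
    0<δ = <⇒0<- ρ<1

    0≤δ : 0ℚ ≤ δ
    0≤δ = ℚ.<⇒≤ 0<δ

    decay : ∀ j → (1ℚ + fromℕ j * δ) * t (j ℕ.+ N) ≤ t N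
    decay zero = ℚ.≤-reflexive (trans (cong (_* t N) (cong (_+_ 1ℚ) (ℚ.*-zeroˡ δ))) (ℚ.*-identityˡ (t N)))
    decay (suc j) = begin
      (1ℚ + fromℕ (suc j) * δ) * t (suc j ℕ.+ N)
        ≤⟨ *-monoˡ-≤ _ (0≤+ 0≤1 (0≤* (0≤fromℕ (suc j)) 0≤δ)) (ratio (j ℕ.+ N) (ℕ.m≤n+m N j)) ⟩
      (1ℚ + fromℕ (suc j) * δ) * (ρ * T)
        ≡⟨ cong (λ z → (1ℚ + z * δ) * (ρ * T)) (fromℕ-suc j) ⟩
      (1ℚ + (1ℚ + J) * δ) * (ρ * T)
        ≤⟨ 0≤-⇒≤ (subst (0ℚ ≤_) gap (0≤* (0≤+ (0≤* (0≤* (0≤fromℕ j) 0≤δ) 0≤δ) (0≤* 0≤δ 0≤δ)) (0≤t (j ℕ.+ N)))) ⟩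
      (1ℚ + J * δ) * T
        ≤⟨ decay j ⟩
      t N ∎
      where
      J = fromℕ j
      T = t (j ℕ.+ N)
      gap : ((J * δ) * δ + δ * δ) * T ≡ (1ℚ + J * δ) * T - (1ℚ + (1ℚ + J) * δ) * (ρ * T)
      gap = solve 3 (λ j r t →
        let d = con 1ℚ :- r in
        ((j :* d) :* d :+ d :* d) :* t :=
        (con 1ℚ :+ j :* d) :* t :- (con 1ℚ :+ (con 1ℚ :+ j) :* d) :* (r :* t)) refl J ρ T

    tail : ∀ n → N ℕ.≤ n → ∀ k → δ * (∑< (k ℕ.+ n) t - ∑< n t) ≤ t n - t (k ℕ.+ n)
    tail n N≤n zero = ℚ.≤-reflexive (trans (cong (δ *_) (ℚ.+-inverseʳ (∑< n t)))
      (trans (ℚ.*-zeroʳ δ) (sym (ℚ.+-inverseʳ (t n)))))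
    tail n N≤n (suc k) = begin
      δ * ((S + T) - ∑< n t)
        ≡⟨ solve 4 (λ d s t u → d :* ((s :+ t) :- u) := d :* (s :- u) :+ d :* t) refl δ S T (∑< n t) ⟩
      δ * (S - ∑< n t) + δ * T
        ≤⟨ ℚ.+-mono-≤ (tail n N≤n k) step ⟩
      (t n - T) + (T - t (suc k ℕ.+ n))
        ≡⟨ solve 3 (λ a b c → (a :- b) :+ (b :- c) := a :- c) refl (t n) T (t (suc k ℕ.+ n)) ⟩
      t n - t (suc k ℕ.+ n) ∎
      where
      S = ∑< (k ℕ.+ n) t
      T = t (k ℕ.+ n)
      step : δ * T ≤ T - t (suc k ℕ.+ n)
      step = subst (_≤ T - t (suc k ℕ.+ n))
        (solve 2 (λ r t → t :- r :* t := (con 1ℚ :- r) :* t) refl ρ T)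
        (ℚ.+-monoʳ-≤ T (ℚ.neg-antimono-≤ (ratio (k ℕ.+ n) (ℕ.≤-trans N≤n (ℕ.m≤n+m n k)))))

    sums-cauchy : IsCauchy (λ n → ∑< n t)
    sums-cauchy ε 0<ε with archimedean (t N) (δ * (δ * ε)) (0<* 0<δ (0<* 0<δ 0<ε))
    ... | j , tN≤ = j ℕ.+ N , bound
      where
      small : ∀ i → j ℕ.≤ i → t (i ℕ.+ N) ≤ δ * ε
      small i j≤i = ℚ.*-cancelˡ-≤-pos w {{positive 0<w}} (begin
        w * t (i ℕ.+ N)          ≤⟨ decay i ⟩
        t N                      ≤⟨ tN≤ ⟩
        fromℕ j * (δ * (δ * ε))  ≡⟨ sym (ℚ.*-assoc (fromℕ j) δ (δ * ε)) ⟩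
        (fromℕ j * δ) * (δ * ε)  ≤⟨ *-monoʳ-≤ (δ * ε) 0≤δε (ℚ.≤-trans (*-monoʳ-≤ δ 0≤δ (fromℕ-mono j≤i))
                                      (subst (_≤ w) (ℚ.+-identityˡ (fromℕ i * δ)) (ℚ.+-monoˡ-≤ (fromℕ i * δ) 0≤1))) ⟩
        w * (δ * ε)              ∎)
        where
        w = 1ℚ + fromℕ i * δ
        0<w : 0ℚ < w
        0<w = ℚ.+-mono-<-≤ 0<1 (0≤* (0≤fromℕ i) 0≤δ)
        0≤δε = ℚ.<⇒≤ (0<* 0<δ 0<ε)

      small′ : ∀ n → j ℕ.+ N ℕ.≤ n → t n ≤ δ * ε
      small′ n h = subst (λ k → t k ≤ δ * ε) (ℕ.m∸n+n≡m (ℕ.≤-trans (ℕ.m≤n+m N j) h))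
        (small (n ∸ N) (ℕ.m+n≤o⇒m≤o∸n j h))

      increasing : ∀ n k → 0ℚ ≤ ∑< (k ℕ.+ n) t - ∑< n t
      increasing n zero    = ℚ.≤-reflexive (sym (ℚ.+-inverseʳ (∑< n t)))
      increasing n (suc k) = subst (0ℚ ≤_)
        (solve 3 (λ a b c → (a :- c) :+ b := (a :+ b) :- c) refl (∑< (k ℕ.+ n) t) (t (k ℕ.+ n)) (∑< n t))
        (0≤+ (increasing n k) (0≤t (k ℕ.+ n)))

      bound₀ : ∀ n k → j ℕ.+ N ℕ.≤ n → ∣ ∑< (k ℕ.+ n) t - ∑< n t ∣ ≤ ε
      bound₀ n k h = subst (_≤ ε) (sym (ℚ.0≤p⇒∣p∣≡p (increasing n k)))
        (ℚ.*-cancelˡ-≤-pos δ {{positive 0<δ}} (begin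
          δ * (∑< (k ℕ.+ n) t - ∑< n t) ≤⟨ tail n (ℕ.≤-trans (ℕ.m≤n+m N j) h) k ⟩
          t n - t (k ℕ.+ n)             ≤⟨ ℚ.+-monoʳ-≤ (t n) (ℚ.neg-antimono-≤ (0≤t (k ℕ.+ n))) ⟩
          t n + 0ℚ                      ≡⟨ ℚ.+-identityʳ (t n) ⟩
          t n                           ≤⟨ small′ n h ⟩
          δ * ε                         ∎))

      bound : ∀ m n → j ℕ.+ N ℕ.≤ m → j ℕ.+ N ℕ.≤ n → ∣ ∑< m t - ∑< n t ∣ ≤ ε
      bound m n hm hn with ℕ.≤-total n m
      ... | inj₁ n≤m = subst (λ i → ∣ ∑< i t - ∑< n t ∣ ≤ ε) (ℕ.m∸n+n≡m n≤m) (bound₀ n (m ∸ n) hn)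
      ... | inj₂ m≤n = subst (_≤ ε) (∣p-q∣≡∣q-p∣ (∑< n t) (∑< m t))
                         (subst (λ i → ∣ ∑< i t - ∑< m t ∣ ≤ ε) (ℕ.m∸n+n≡m m≤n) (bound₀ m (n ∸ m) hm))

  -- Weierstrass M-test for a series of functions whose terms are bounded by,
  -- and Lipschitz with constant, M i on the ball of radius r.
  series-cauchy :
    (e : ℕ → ℚ → ℚ) (M : ℕ → ℚ) (r : ℚ) → IsCauchy (λ n → ∑< n M) →
    (∀ i p → ∣ p ∣ ≤ r → ∣ e i p ∣ ≤ M i) →
    (∀ i p q → ∣ p ∣ ≤ r → ∣ q ∣ ≤ r → ∣ e i p - e i q ∣ ≤ M i * ∣ p - q ∣) →
    ∀ {s} → IsCauchy s → ∀ {N} → (∀ n → N ℕ.≤ n → ∣ s n ∣ ≤ r) →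
    IsCauchy (λ n → ∑< n (λ i → e i (s n)))
  series-cauchy e M r cM size lip {s} cs {N} ball ε 0<ε = go (Cauchy⇒bounded cM)
    where
    h₃ = cM (ε * ½) (0<half 0<ε)
    N₃ = proj₁ h₃
    go : (∃ λ K → 0ℚ < K × ∃ λ N → ∀ n → N ℕ.≤ n → ∣ ∑< n M ∣ ≤ K) →
         ∃ λ N → ∀ m n → N ℕ.≤ m → N ℕ.≤ n →
           ∣ ∑< m (λ i → e i (s m)) - ∑< n (λ i → e i (s n)) ∣ ≤ ε
    go (K , 0<K , N₁ , bK) = N₄ ℕ.⊔ N₅ , bound
      where
      h₂ = Cauchy-* {s} cs 0<K (ε * ½) (0<half 0<ε)
      N₂ = proj₁ h₂
      N₄ = N ℕ.⊔ N₁
      N₅ = N₂ ℕ.⊔ N₃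
      bound : ∀ m n → N₄ ℕ.⊔ N₅ ℕ.≤ m → N₄ ℕ.⊔ N₅ ℕ.≤ n →
              ∣ ∑< m (λ i → e i (s m)) - ∑< n (λ i → e i (s n)) ∣ ≤ ε
      bound m n Nm Nn = ℚ.≤-trans
        (triangle (∑< m (λ i → e i (s m))) (∑< m (λ i → e i (s n))) (∑< n (λ i → e i (s n))))
        (≤-half
          (ℚ.≤-trans (∑-distance (λ i → e i (s m)) (λ i → e i (s n)) M ∣ s m - s n ∣
              (λ i → lip i (s m) (s n) ballₘ ballₙ) m)
          (ℚ.≤-trans (*-monoʳ-≤ ∣ s m - s n ∣ (ℚ.0≤∣p∣ (s m - s n))
              (ℚ.≤-trans (p≤∣p∣ (∑< m M)) (bK m (r⊔ N N₁ (l⊔ N₄ N₅ Nm)))))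
            (proj₂ h₂ m n (l⊔ N₂ N₃ (r⊔ N₄ N₅ Nm)) (l⊔ N₂ N₃ (r⊔ N₄ N₅ Nn)))))
          (ℚ.≤-trans (∑-tail′ (λ i → e i (s n)) M (λ i → size i (s n) ballₙ) m n)
            (proj₂ h₃ m n (r⊔ N₂ N₃ (r⊔ N₄ N₅ Nm)) (r⊔ N₂ N₃ (r⊔ N₄ N₅ Nn)))))
        where
        ballₘ = ball m (l⊔ N N₁ (l⊔ N₄ N₅ Nm))
        ballₙ = ball n (l⊔ N N₁ (l⊔ N₄ N₅ Nn))

  expTerm : ℕ → ℚ → ℚ
  expTerm i p = p ^ i * 1/! i

  mercatorTerm : ℕ → ℚ → ℚ
  mercatorTerm i p = p ^ suc i * 1/ℕ (suc i)

  scaled-distance : ∀ {p q b} c → 0ℚ ≤ c → ∣ p - q ∣ ≤ b → ∣ p * c - q * c ∣ ≤ b * c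
  scaled-distance {p} {q} {b} c 0≤c h = begin
    ∣ p * c - q * c ∣   ≡⟨ cong ∣_∣ (solve 3 (λ a b c → a :* c :- b :* c := (a :- b) :* c) refl p q c) ⟩
    ∣ (p - q) * c ∣     ≡⟨ ℚ.∣p*q∣≡∣p∣*∣q∣ (p - q) c ⟩
    ∣ p - q ∣ * ∣ c ∣   ≡⟨ cong (∣ p - q ∣ *_) (ℚ.0≤p⇒∣p∣≡p 0≤c) ⟩
    ∣ p - q ∣ * c       ≤⟨ *-monoʳ-≤ c 0≤c h ⟩
    b * c               ∎

  scaled-size : ∀ {p b} c → 0ℚ ≤ c → ∣ p ∣ ≤ b → ∣ p * c ∣ ≤ b * c
  scaled-size {p} {b} c 0≤c h = subst (_≤ b * c)
    (sym (trans (ℚ.∣p*q∣≡∣p∣*∣q∣ p c) (cong (∣ p ∣ *_) (ℚ.0≤p⇒∣p∣≡p 0≤c))))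
    (*-monoʳ-≤ c 0≤c h)

  module ExpBound (K : ℚ) (0<K : 0ℚ < K) where

    r R : ℚ
    r = K + 1ℚ
    R = (1ℚ + 1ℚ) * r
    M : ℕ → ℚ
    M i = expTerm i R
    ½<1 : ½ < 1ℚ
    ½<1 = ℚ.*<* (ℤ.+<+ (ℕ.s≤s (ℕ.s≤s ℕ.z≤n)))
    1≤r : 1ℚ ≤ r
    1≤r = subst (_≤ r) (ℚ.+-identityˡ 1ℚ) (ℚ.+-monoˡ-≤ 1ℚ (ℚ.<⇒≤ 0<K))
    0≤r : 0ℚ ≤ r
    0≤r = ℚ.≤-trans 0≤1 1≤r
    r≤R : r ≤ R
    r≤R = subst (r ≤_) (solve 1 (λ a → a :+ a := (con 1ℚ :+ con 1ℚ) :* a) refl r) (≤+ 0≤r)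
    0≤R : 0ℚ ≤ R
    0≤R = ℚ.≤-trans 0≤r r≤R
    0≤M : ∀ i → 0ℚ ≤ M i
    0≤M i = 0≤* (0≤^ 0≤R i) (0≤1/! i)
    ratio : ∀ L → R ≤ fromℕ L * ½ → ∀ i → L ℕ.≤ i → M (suc i) ≤ ½ * M i
    ratio L R≤ i L≤i = begin
      (R * R ^ i) * 1/! (suc i)
        ≡⟨ cong ((R * R ^ i) *_) (1/!-suc i) ⟩
      (R * R ^ i) * (1/ℕ (suc i) * 1/! i)
        ≡⟨ solve 4 (λ a b c d → (a :* b) :* (c :* d) := (a :* c) :* (b :* d)) refl R (R ^ i) (1/ℕ (suc i)) (1/! i) ⟩
      (R * 1/ℕ (suc i)) * M i
        ≤⟨ *-monoʳ-≤ (M i) (0≤M i) (*-monoʳ-≤ (1/ℕ (suc i)) (ℚ.<⇒≤ (0<1/ℕ (suc i)))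
             (ℚ.≤-trans R≤ (*-monoʳ-≤ ½ (ℚ.<⇒≤ 0<½) (fromℕ-mono (ℕ.m≤n⇒m≤1+n L≤i))))) ⟩
      ((fromℕ (suc i) * ½) * 1/ℕ (suc i)) * M i
        ≡⟨ cong (_* M i) (trans (solve 3 (λ a b c → (a :* b) :* c := b :* (a :* c)) refl (fromℕ (suc i)) ½ (1/ℕ (suc i)))
             (trans (cong (½ *_) (fromℕ*1/ℕ (suc i))) (ℚ.*-identityʳ ½))) ⟩
      ½ * M i ∎
    ^-mono : ∀ i → r ^ i ≤ R ^ i
    ^-mono zero    = ℚ.≤-refl
    ^-mono (suc i) = *-mono-≤ 0≤r (0≤^ 0≤R i) r≤R (^-mono i)
    size : ∀ i p → ∣ p ∣ ≤ r → ∣ expTerm i p ∣ ≤ M i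
    size i p h = scaled-size {p ^ i} (1/! i) (0≤1/! i) (∣^∣≤ (ℚ.≤-trans h r≤R) i)
    ^-lip : ∀ i p q → ∣ p ∣ ≤ r → ∣ q ∣ ≤ r → ∣ p ^ i - q ^ i ∣ ≤ R ^ i * ∣ p - q ∣
    ^-lip zero p q _ _ = 0≤* 0≤1 (ℚ.0≤∣p∣ (p - q))
    ^-lip (suc i) p q hp hq = begin
      ∣ p * p ^ i - q * q ^ i ∣
        ≤⟨ *-distance p (p ^ i) q (q ^ i) ⟩
      ∣ p ∣ * ∣ p ^ i - q ^ i ∣ + ∣ q ^ i ∣ * D
        ≤⟨ ℚ.+-mono-≤
             (*-mono-≤ (ℚ.0≤∣p∣ p) (0≤* (0≤^ 0≤R i) 0≤D) hp (^-lip i p q hp hq))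
             (*-monoʳ-≤ D 0≤D (ℚ.≤-trans (∣^∣≤ hq i) (ℚ.≤-trans (^-mono i) R^i≤))) ⟩
      r * (R ^ i * D) + (r * R ^ i) * D
        ≡⟨ solve 3 (λ a b c → a :* (b :* c) :+ (a :* b) :* c := (((con 1ℚ :+ con 1ℚ) :* a) :* b) :* c) refl r (R ^ i) D ⟩
      (R * R ^ i) * D ∎
      where
      D = ∣ p - q ∣
      0≤D = ℚ.0≤∣p∣ (p - q)
      R^i≤ : R ^ i ≤ r * R ^ i
      R^i≤ = subst (_≤ r * R ^ i) (ℚ.*-identityˡ (R ^ i)) (*-monoʳ-≤ (R ^ i) (0≤^ 0≤R i) 1≤r)
    lip : ∀ i p q → ∣ p ∣ ≤ r → ∣ q ∣ ≤ r → ∣ expTerm i p - expTerm i q ∣ ≤ M i * ∣ p - q ∣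
    lip i p q hp hq = subst (∣ expTerm i p - expTerm i q ∣ ≤_)
      (solve 3 (λ a b c → (a :* b) :* c := (a :* c) :* b) refl (R ^ i) ∣ p - q ∣ (1/! i))
      (scaled-distance {p ^ i} {q ^ i} (1/! i) (0≤1/! i) (^-lip i p q hp hq))

    sums-cauchy : IsCauchy (λ n → ∑< n M)
    sums-cauchy = go (archimedean R ½ 0<½)
      where
      go : (∃ λ L → R ≤ fromℕ L * ½) → IsCauchy (λ n → ∑< n M)
      go (L , R≤) = RatioTest.sums-cauchy M 0≤M ½ (ℚ.<⇒≤ 0<½) ½<1 L (ratio L R≤)

  exp-cauchy : ∀ {s} → IsCauchy s → IsCauchy (λ n → ∑< n (λ i → expTerm i (s n)))
  exp-cauchy {s} cs = go (Cauchy⇒bounded {s} cs)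
    where
    go : (∃ λ K → 0ℚ < K × ∃ λ N → ∀ n → N ℕ.≤ n → ∣ s n ∣ ≤ K) →
         IsCauchy (λ n → ∑< n (λ i → expTerm i (s n)))
    go (K , 0<K , N , b) =
      series-cauchy expTerm M r sums-cauchy size lip {s} cs {N} (λ n Nn → ℚ.≤-trans (b n Nn) (≤+ 0≤1))
      where open ExpBound K 0<K

  mercator-cauchy : ∀ {s r N} → 0ℚ ≤ r → r < 1ℚ → (∀ n → N ℕ.≤ n → ∣ s n ∣ ≤ r) → IsCauchy s →
                    IsCauchy (λ n → ∑< n (λ i → mercatorTerm i (s n)))
  mercator-cauchy {s} {r} {N} 0≤r r<1 ball cs =
    series-cauchy mercatorTerm (r ^_) r
      (RatioTest.sums-cauchy (r ^_) (0≤^ 0≤r) r 0≤r r<1 0 (λ _ _ → ℚ.≤-refl)) size lip cs {N} ball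
    where
    1/ℕ≤1 : ∀ i → 1/ℕ (suc i) ≤ 1ℚ
    1/ℕ≤1 i = subst₂ _≤_ (ℚ.*-identityˡ (1/ℕ (suc i))) (fromℕ*1/ℕ (suc i))
      (*-monoʳ-≤ (1/ℕ (suc i)) (ℚ.<⇒≤ (0<1/ℕ (suc i))) (fromℕ-mono {1} {suc i} (ℕ.s≤s ℕ.z≤n)))
    size : ∀ i p → ∣ p ∣ ≤ r → ∣ mercatorTerm i p ∣ ≤ r ^ i
    size i p h = begin
      ∣ mercatorTerm i p ∣     ≤⟨ scaled-size {p ^ suc i} (1/ℕ (suc i)) (ℚ.<⇒≤ (0<1/ℕ (suc i))) (∣^∣≤ h (suc i)) ⟩
      (r * r ^ i) * 1/ℕ (suc i) ≤⟨ *-monoˡ-≤ (r * r ^ i) (0≤^ 0≤r (suc i)) (1/ℕ≤1 i) ⟩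
      (r * r ^ i) * 1ℚ         ≡⟨ ℚ.*-identityʳ (r * r ^ i) ⟩
      r * r ^ i                ≤⟨ *-monoʳ-≤ (r ^ i) (0≤^ 0≤r i) (ℚ.<⇒≤ r<1) ⟩
      1ℚ * r ^ i               ≡⟨ ℚ.*-identityˡ (r ^ i) ⟩
      r ^ i                    ∎
    lip : ∀ i p q → ∣ p ∣ ≤ r → ∣ q ∣ ≤ r → ∣ mercatorTerm i p - mercatorTerm i q ∣ ≤ r ^ i * ∣ p - q ∣
    lip i p q hp hq = subst (∣ mercatorTerm i p - mercatorTerm i q ∣ ≤_)
      (trans (solve 4 (λ a b c d → ((a :* b) :* c) :* d := (a :* d) :* (b :* c)) refl
               (fromℕ (suc i)) (r ^ i) ∣ p - q ∣ (1/ℕ (suc i)))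
        (trans (cong (_* (r ^ i * ∣ p - q ∣)) (fromℕ*1/ℕ (suc i))) (ℚ.*-identityˡ _)))
      (scaled-distance {p ^ suc i} {q ^ suc i} (1/ℕ (suc i)) (ℚ.<⇒≤ (0<1/ℕ (suc i))) (^-lipschitz hp hq i))

open RationalLemmas

infix  4 _≈_ _≤_ _<_
infixl 6 _+_ _-_
infixl 7 _*_
infix  8 -_

-- Cauchy sequences of rationals; equality of reals is _≈_, i.e. equality up to
-- a null sequence.
record ℝ : Set where
  constructor mkℝ
  field
    seq    : ℕ → ℚ
    cauchy : IsCauchy seq

open ℝ public

_≈_ : ℝ → ℝ → Set
x ≈ y = ∀ ε → 0ℚ ℚ.< ε → ∃ λ N → ∀ n → N ℕ.≤ n → ℚ.∣ seq x n ℚ.- seq y n ∣ ℚ.≤ ε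

_≤_ : ℝ → ℝ → Set
x ≤ y = ∀ ε → 0ℚ ℚ.< ε → ∃ λ N → ∀ n → N ℕ.≤ n → seq x n ℚ.≤ seq y n ℚ.+ ε

_<_ : ℝ → ℝ → Set
x < y = ∃ λ ε → 0ℚ ℚ.< ε × ∃ λ N → ∀ n → N ℕ.≤ n → seq x n ℚ.+ ε ℚ.≤ seq y n

ι : ℚ → ℝ
ι p = mkℝ (λ _ → p) (const-cauchy p)

0ℝ 1ℝ : ℝ
0ℝ = ι 0ℚ
1ℝ = ι 1ℚ

_+_ : ℝ → ℝ → ℝ
x + y = mkℝ (λ n → seq x n ℚ.+ seq y n) (+-cauchy {seq x} {seq y} (cauchy x) (cauchy y))

_*_ : ℝ → ℝ → ℝ
x * y = mkℝ (λ n → seq x n ℚ.* seq y n) (*-cauchy {seq x} {seq y} (cauchy x) (cauchy y))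

-_ : ℝ → ℝ
- x = mkℝ (λ n → ℚ.- seq x n) (neg-cauchy {seq x} (cauchy x))

_-_ : ℝ → ℝ → ℝ
x - y = x + - y

∣_∣ : ℝ → ℝ
∣ x ∣ = mkℝ (λ n → ℚ.∣ seq x n ∣) (abs-cauchy {seq x} (cauchy x))

inv : (x : ℝ) → 0ℝ < x → ℝ
inv x (δ , 0<δ , N , lower) = mkℝ (λ n → recip (seq x n))
  (recip-cauchy {seq x} {δ} {N} 0<δ
    (λ n Nn → subst (ℚ._≤ seq x n) (ℚ.+-identityˡ δ) (lower n Nn)) (cauchy x))

≡⇒≈ : ∀ {x y} → (∀ n → seq x n ≡ seq y n) → x ≈ y
≡⇒≈ {x} {y} h ε 0<ε = 0 , λ n _ →
  subst (ℚ._≤ ε) (sym (cong ℚ.∣_∣ (trans (cong (ℚ._- seq y n) (h n)) (ℚ.+-inverseʳ (seq y n))))) (ℚ.<⇒≤ 0<ε)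

≈-refl : ∀ {x} → x ≈ x
≈-refl {x} = ≡⇒≈ {x} {x} (λ _ → refl)

≈-sym : ∀ {x y} → x ≈ y → y ≈ x
≈-sym {x} {y} h ε 0<ε = proj₁ (h ε 0<ε) , λ n Nn →
  subst (ℚ._≤ ε) (∣p-q∣≡∣q-p∣ (seq x n) (seq y n)) (proj₂ (h ε 0<ε) n Nn)

≈-trans : ∀ {x y z} → x ≈ y → y ≈ z → x ≈ z
≈-trans {x} {y} {z} h h′ ε 0<ε = N₁ ℕ.⊔ N₂ , λ n Nn →
  ℚ.≤-trans (triangle (seq x n) (seq y n) (seq z n))
    (≤-half (proj₂ e₁ n (l⊔ N₁ N₂ Nn)) (proj₂ e₂ n (r⊔ N₁ N₂ Nn)))
  where
  e₁ = h (ε ℚ.* ½) (0<half 0<ε)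
  e₂ = h′ (ε ℚ.* ½) (0<half 0<ε)
  N₁ = proj₁ e₁
  N₂ = proj₁ e₂

+-cong : ∀ {x y u v} → x ≈ y → u ≈ v → x + u ≈ y + v
+-cong {x} {y} {u} {v} h h′ ε 0<ε = N₁ ℕ.⊔ N₂ , λ n Nn →
  ℚ.≤-trans (+-distance (seq x n) (seq u n) (seq y n) (seq v n))
    (≤-half (proj₂ e₁ n (l⊔ N₁ N₂ Nn)) (proj₂ e₂ n (r⊔ N₁ N₂ Nn)))
  where
  e₁ = h (ε ℚ.* ½) (0<half 0<ε)
  e₂ = h′ (ε ℚ.* ½) (0<half 0<ε)
  N₁ = proj₁ e₁
  N₂ = proj₁ e₂

-‿cong : ∀ {x y} → x ≈ y → - x ≈ - y
-‿cong {x} {y} h ε 0<ε = proj₁ (h ε 0<ε) , λ n Nn →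
  subst (ℚ._≤ ε) (sym (neg-distance (seq x n) (seq y n))) (proj₂ (h ε 0<ε) n Nn)

*-cong : ∀ {x y u v} → x ≈ y → u ≈ v → x * u ≈ y * v
*-cong {x} {y} {u} {v} h h′ ε 0<ε = go (Cauchy⇒bounded {seq x} (cauchy x)) (Cauchy⇒bounded {seq v} (cauchy v))
  where
  scale : ∀ {x y} → x ≈ y → ∀ {K} → 0ℚ ℚ.< K →
          ∃ λ N → ∀ n → N ℕ.≤ n → K ℚ.* ℚ.∣ seq x n ℚ.- seq y n ∣ ℚ.≤ ε ℚ.* ½
  scale h {K} 0<K = proj₁ e , λ n Nn →
    subst (_ ℚ.≤_) (*-shrink (ε ℚ.* ½) 0<K) (*-monoˡ-≤ K (ℚ.<⇒≤ 0<K) (proj₂ e n Nn))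
    where e = h (shrink K (ε ℚ.* ½)) (0<shrink 0<K (0<half 0<ε))
  go : (∃ λ K → 0ℚ ℚ.< K × ∃ λ N → ∀ n → N ℕ.≤ n → ℚ.∣ seq x n ∣ ℚ.≤ K) →
       (∃ λ L → 0ℚ ℚ.< L × ∃ λ N → ∀ n → N ℕ.≤ n → ℚ.∣ seq v n ∣ ℚ.≤ L) →
       ∃ λ N → ∀ n → N ℕ.≤ n → ℚ.∣ seq x n ℚ.* seq u n ℚ.- seq y n ℚ.* seq v n ∣ ℚ.≤ ε
  go (K , 0<K , N₁ , b₁) (L , 0<L , N₂ , b₂) = N₅ ℕ.⊔ N₆ , λ n Nn →
    ℚ.≤-trans (*-distance (seq x n) (seq u n) (seq y n) (seq v n))
      (≤-half
        (ℚ.≤-trans (*-monoʳ-≤ _ (ℚ.0≤∣p∣ (seq u n ℚ.- seq v n)) (b₁ n (l⊔ N₁ N₃ (l⊔ N₅ N₆ Nn))))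
          (proj₂ e₁ n (r⊔ N₁ N₃ (l⊔ N₅ N₆ Nn))))
        (ℚ.≤-trans (*-monoʳ-≤ _ (ℚ.0≤∣p∣ (seq x n ℚ.- seq y n)) (b₂ n (l⊔ N₂ N₄ (r⊔ N₅ N₆ Nn))))
          (proj₂ e₂ n (r⊔ N₂ N₄ (r⊔ N₅ N₆ Nn)))))
    where
    e₁ = scale {u} {v} h′ 0<K
    e₂ = scale {x} {y} h 0<L
    N₃ = proj₁ e₁
    N₄ = proj₁ e₂
    N₅ = N₁ ℕ.⊔ N₃
    N₆ = N₂ ℕ.⊔ N₄

ℝ-commutativeRing : CommutativeRing 0ℓ 0ℓ
ℝ-commutativeRing = record
  { Carrier = ℝ
  ; _≈_ = _≈_
  ; _+_ = _+_
  ; _*_ = _*_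
  ; -_  = -_
  ; 0#  = 0ℝ
  ; 1#  = 1ℝ
  ; isCommutativeRing = record
    { isRing = record
      { +-isAbelianGroup = record
        { isGroup = record
          { isMonoid = record
            { isSemigroup = record
              { isMagma = record
                { isEquivalence = record
                  { refl  = λ {x} → ≈-refl {x}
                  ; sym   = λ {x} {y} → ≈-sym {x} {y}
                  ; trans = λ {x} {y} {z} → ≈-trans {x} {y} {z}
                  }
                ; ∙-cong = λ {x} {y} {u} {v} → +-cong {x} {y} {u} {v}
                }
              ; assoc = λ x y z → ≡⇒≈ {(x + y) + z} {x + (y + z)} λ n → ℚ.+-assoc (seq x n) (seq y n) (seq z n)
              }
            ; identity = (λ x → ≡⇒≈ {0ℝ + x} {x} λ n → ℚ.+-identityˡ (seq x n))
                       , (λ x → ≡⇒≈ {x + 0ℝ} {x} λ n → ℚ.+-identityʳ (seq x n))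
            }
          ; inverse = (λ x → ≡⇒≈ { - x + x} {0ℝ} λ n → ℚ.+-inverseˡ (seq x n))
                    , (λ x → ≡⇒≈ {x + - x} {0ℝ} λ n → ℚ.+-inverseʳ (seq x n))
          ; ⁻¹-cong = λ {x} {y} → -‿cong {x} {y}
          }
        ; comm = λ x y → ≡⇒≈ {x + y} {y + x} λ n → ℚ.+-comm (seq x n) (seq y n)
        }
      ; *-cong = λ {x} {y} {u} {v} → *-cong {x} {y} {u} {v}
      ; *-assoc = λ x y z → ≡⇒≈ {(x * y) * z} {x * (y * z)} λ n → ℚ.*-assoc (seq x n) (seq y n) (seq z n)
      ; *-identity = (λ x → ≡⇒≈ {1ℝ * x} {x} λ n → ℚ.*-identityˡ (seq x n))
                   , (λ x → ≡⇒≈ {x * 1ℝ} {x} λ n → ℚ.*-identityʳ (seq x n))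
      ; distrib = (λ x y z → ≡⇒≈ {x * (y + z)} {x * y + x * z} λ n → ℚ.*-distribˡ-+ (seq x n) (seq y n) (seq z n))
                , (λ x y z → ≡⇒≈ {(y + z) * x} {y * x + z * x} λ n → ℚ.*-distribʳ-+ (seq x n) (seq y n) (seq z n))
      }
    ; *-comm = λ x y → ≡⇒≈ {x * y} {y * x} λ n → ℚ.*-comm (seq x n) (seq y n)
    }
  }

open RawSemiringDefs (Semiring.rawSemiring (CommutativeRing.semiring ℝ-commutativeRing)) public using (_^_; sum)

-- The limit of the diagonal sequence n ↦ ∑_{i<n} xₙⁱ / i!.
exp : ℝ → ℝ
exp x = mkℝ (λ n → ∑< n (λ i → expTerm i (seq x n))) (exp-cauchy {seq x} (cauchy x))

-- log q = - ∑_{i≥1} (1 - q)ⁱ / i, which converges because |1 - q| < 1.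
log : (q : ℝ) → 0ℝ < q → q < 1ℝ → ℝ
log q (δ , 0<δ , N₁ , lower) (δ′ , 0<δ′ , N₂ , upper) =
  - mkℝ (λ n → ∑< n (λ i → mercatorTerm i (seq (1ℝ - q) n)))
        (mercator-cauchy {seq (1ℝ - q)} {r} {N₁ ℕ.⊔ N₂} 0≤r r<1 ball (cauchy (1ℝ - q)))
  where
  r = 1ℚ ℚ.- δ
  u = seq (1ℝ - q)
  r<1 : r ℚ.< 1ℚ
  r<1 = subst (r ℚ.<_) (ℚ.+-identityʳ 1ℚ) (ℚ.+-monoʳ-< 1ℚ (ℚ.neg-antimono-< 0<δ))
  ball : ∀ n → N₁ ℕ.⊔ N₂ ℕ.≤ n → ℚ.∣ u n ∣ ℚ.≤ r
  ball n Nn = subst (ℚ._≤ r) (sym (ℚ.0≤p⇒∣p∣≡p 0≤u))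
    (ℚ.+-monoʳ-≤ 1ℚ (ℚ.neg-antimono-≤ (subst (ℚ._≤ seq q n) (ℚ.+-identityˡ δ) (lower n (l⊔ N₁ N₂ Nn)))))
    where
    0≤u : 0ℚ ℚ.≤ u n
    0≤u = ≤⇒0≤- {seq q n} {1ℚ} (ℚ.≤-trans (≤+ (ℚ.<⇒≤ 0<δ′)) (upper n (r⊔ N₁ N₂ Nn)))
  0≤r : 0ℚ ℚ.≤ r
  0≤r = ℚ.≤-trans (ℚ.0≤∣p∣ (u (N₁ ℕ.⊔ N₂))) (ball (N₁ ℕ.⊔ N₂) ℕ.≤-refl)

rpow : (q : ℝ) → 0ℝ < q → q < 1ℝ → ℝ → ℝ
rpow q 0<q q<1 x = exp (x * log q 0<q q<1)

-- Formal power series in t, as coefficient sequences.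
PowerSeries : Set
PowerSeries = ℕ → ℝ

infixl 7 _⊛_ _•_

_⊛_ : PowerSeries → PowerSeries → PowerSeries
(f ⊛ g) n = sum {suc n} (λ i → f (toℕ i) * g (n ∸ toℕ i))

_•_ : ℝ → PowerSeries → PowerSeries
(c • f) n = c * f n

t^_ : ℕ → PowerSeries
(t^ k) n = if n ℕ.≡ᵇ k then 1ℝ else 0ℝ

e^[_]t : ℝ → PowerSeries
e^[ a ]t n = a ^ n * ι (1/! n)

record [0,1] : Set where
  constructor mkUnit
  field
    pt   : ℝ
    0≤pt : 0ℝ ≤ pt
    pt≤1 : pt ≤ 1ℝ

open [0,1] public

record C[0,1] : Set where
  field
    fun : [0,1] → ℝ
    continuous : ∀ x ε → 0ℝ < ε → ∃ λ δ → 0ℝ < δ ×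
                 (∀ y → ∣ pt x - pt y ∣ < δ → ∣ fun x - fun y ∣ < ε)

open C[0,1] public

one : C[0,1]
one = record
  { fun = λ _ → 1ℝ
  ; continuous = λ x ε 0<ε → 1ℝ , (1ℚ , 0<1 , 0 , λ _ _ → ℚ.≤-refl) , λ _ _ → 0<ε
  }

ι-mono : ∀ {p q} → p ℚ.≤ q → ι p ≤ ι q
ι-mono p≤q ε 0<ε = 0 , λ _ _ → ℚ.≤-trans p≤q (≤+ (ℚ.<⇒≤ 0<ε))

-- j / n; the value at n = 0, where the quotient 0 / 0 is undefined, is
-- conventionally 0.
node : (n : ℕ) → Fin (suc n) → [0,1]
node zero    _ = mkUnit 0ℝ (ι-mono ℚ.≤-refl) (ι-mono 0≤1)
node (suc m) j = mkUnit (ι (+ toℕ j ℚ./ suc m))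
  (ι-mono (ℚ.nonNegative⁻¹ (+ toℕ j ℚ./ suc m) {{ℚ.normalize-nonNeg (toℕ j) (suc m)}}))
  (ι-mono (ℚ.toℚᵘ-cancel-≤ (ℚᵘ.≤-respˡ-≃
    (ℚᵘ.≃-sym (ℚ.toℚᵘ-fromℚᵘ (ℚᵘ.mkℚᵘ (+ toℕ j) m)))
    (ℚᵘ.*≤* (subst₂ ℤ._≤_ (sym (ℤ.*-identityʳ (+ toℕ j))) (sym (ℤ.*-identityˡ (+ suc m)))
      (ℤ.+≤+ (Fin.toℕ≤pred[n] j)))))))

module QBernstein (q : ℝ) (0<q : 0ℝ < q) (q<1 : q < 1ℝ) where

  0<1-q : 0ℝ < 1ℝ - q
  0<1-q = let (ε , 0<ε , N , h) = q<1 in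
    ε , 0<ε , N , λ n Nn → subst₂ ℚ._≤_
      (solve 2 (λ a e → (a :+ e) :- a := con 0ℚ :+ e) refl (seq q n) ε) refl
      (ℚ.+-monoˡ-≤ (ℚ.- seq q n) (h n Nn))
    where open +-*-Solver using (solve; _:+_; _:-_; _:=_; con)

  [_]q : ℝ → ℝ
  [ x ]q = (1ℝ - rpow q 0<q q<1 x) * inv (1ℝ - q) 0<1-q

  -- t^k e^{[1-x]t} [x]^k / k!
  generating : ℕ → ℝ → PowerSeries
  generating k x = ([ x ]q ^ k * ι (1/! k)) • (t^ k ⊛ e^[ [ 1ℝ - x ]q ]t)

  -- Exponential coefficients: generating k x = ∑ₙ B k n x tⁿ / n!.
  B : ℕ → ℕ → ℝ → ℝ
  B k n x = ι (fromℕ (n !)) * generating k x n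

  B-generating : ∀ k x n → B k n x * ι (1/! n) ≈ generating k x n
  B-generating k x n = ≡⇒≈ {B k n x * ι (1/! n)} {generating k x n} λ i →
    trans (solve 3 (λ a g b → (a :* g) :* b := (a :* b) :* g) refl (fromℕ (n !)) (seq (generating k x n) i) (1/! n))
    (trans (cong (ℚ._* seq (generating k x n) i) (fromℕ*1/ℕ (n !) {{ℕ._!≢0 n}}))
      (ℚ.*-identityˡ (seq (generating k x n) i)))
    where open +-*-Solver using (solve; _:*_; _:=_)

  operator : ℕ → C[0,1] → ℝ → ℝ
  operator n f x = sum {suc n} (λ j → fun f (node n j) * B (toℕ j) n x)

{-# OPTIONS --safe #-}

-- Write [x] for the q-number of x.  Reading off coefficients, B_{k,n}(x) is
-- n! · [x]ᵏ/k! · [1-x]ⁿ⁻ᵏ/(n-k)!.  This is visibly symmetric, and by the binomial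
-- theorem it sums to ([x] + [1-x])ⁿ.  That [x] + [1-x] = 1 + [x][1-x](1-q) amounts
-- to qˣ q¹⁻ˣ = q, i.e. to the addition theorem for exp and to exp (log q) = q.
--
-- For the latter put u = 1 - q and L(u) = ∑ uⁱ/i.  For 0 ≤ w ≤ v,
-- (v-w)/(1-w) ≤ L(v) - L(w) ≤ (v-w)/(1-v) and
-- eʷ(1 + (v-w)) ≤ eᵛ ≤ eʷ/(1 - (v-w)).  Going from 0 to u in m steps of length δ,
-- the resulting products telescope to 1/(1-u+δ) ≤ exp (L u) ≤ 1/(1-u-δ).  Both
-- bounds hold already for suitable partial sums of the two series, so the argument
-- takes place among rational numbers.

module Submission where

import Algebra.Definitions.RawSemiring as RawSemiringDefs
import Algebra.Properties.CommutativeSemiring.Binomial as Binomial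
import Algebra.Properties.Semiring.Exp as SemiringExp
import Algebra.Properties.Semiring.Sum as SemiringSum
open import Algebra.Bundles using (CommutativeRing)
open import Data.Fin.Base as Fin using (Fin; toℕ)
import Data.Fin.Properties as Fin
open import Data.Nat.Base as ℕ using (ℕ; zero; suc; _∸_; _!)
open import Data.Nat.Combinatorics using (_C_; nCk≡n!/k![n-k]!; k![n∸k]!∣n!)
import Data.Nat.DivMod as ℕ
import Data.Nat.Properties as ℕ
open import Data.Product.Base using (∃; _×_; _,_; proj₁; proj₂)
open import Data.Rational.Base as ℚ using (ℚ; 0ℚ; 1ℚ; ½)
import Data.Rational.Base
import Data.Rational.Properties as ℚ
open import Data.Rational.Solver using (module +-*-Solver)
open import Relation.Binary.PropositionalEquality using (_≡_; refl; sym; trans; cong; cong₂; subst; subst₂; module ≡-Reasoning)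
import Relation.Binary.Reasoning.Setoid as SetoidReasoning
import Defs

-- Difference bounds for powers and for the terms of both series

module RationalEstimates where

  open Defs.RationalLemmas
  open Data.Rational.Base using (_+_; _*_; -_; _-_; ∣_∣; _≤_)
  open RawSemiringDefs ℚ.+-*-rawSemiring using (_^_)
  open +-*-Solver using (solve; _:+_; _:*_; _:-_; _:=_; con)
  open ℚ.≤-Reasoning

  ^-mono : ∀ {w v} → 0ℚ ≤ w → w ≤ v → ∀ i → w ^ i ≤ v ^ i
  ^-mono 0≤w w≤v zero    = ℚ.≤-refl
  ^-mono 0≤w w≤v (suc i) =
    *-mono-≤ 0≤w (0≤^ (ℚ.≤-trans 0≤w w≤v) i) w≤v (^-mono 0≤w w≤v i)

  -- Mean value bound with the derivative taken at the left endpoint. The induction splits the next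
  -- difference as v (v^(i+1) - w^(i+1)) + w^(i+1) (v - w).
  ^-difference-≥ : ∀ {w v} → 0ℚ ≤ w → w ≤ v → ∀ i →
                   (fromℕ (suc i) * w ^ i) * (v - w) ≤ v ^ suc i - w ^ suc i
  ^-difference-≥ {w} {v} 0≤w w≤v zero = ℚ.≤-reflexive
    (solve 2 (λ w v → (con 1ℚ :* con 1ℚ) :* (v :- w) := v :* con 1ℚ :- w :* con 1ℚ) refl w v)
  ^-difference-≥ {w} {v} 0≤w w≤v (suc i) = begin
    (fromℕ (suc (suc i)) * (w * w ^ i)) * D
      ≡⟨ cong (λ z → (z * (w * w ^ i)) * D) (fromℕ-suc (suc i)) ⟩
    ((1ℚ + fromℕ (suc i)) * (w * w ^ i)) * D
      ≡⟨ solve 4 (λ k w p d → ((con 1ℚ :+ k) :* (w :* p)) :* d := w :* ((k :* p) :* d) :+ (w :* p) :* d)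
           refl (fromℕ (suc i)) w (w ^ i) D ⟩
    w * ((fromℕ (suc i) * w ^ i) * D) + w ^ suc i * D
      ≤⟨ ℚ.+-monoˡ-≤ (w ^ suc i * D) (*-mono-≤ 0≤w 0≤diff w≤v (^-difference-≥ 0≤w w≤v i)) ⟩
    v * (v ^ suc i - w ^ suc i) + w ^ suc i * D
      ≡⟨ solve 4 (λ w v p r → v :* (r :- p) :+ p :* (v :- w) := v :* r :- w :* p)
           refl w v (w ^ suc i) (v ^ suc i) ⟩
    v ^ suc (suc i) - w ^ suc (suc i) ∎
    where
    D = v - w
    0≤diff = ≤⇒0≤- (^-mono 0≤w w≤v (suc i))

  ^-difference-≤ : ∀ {w v} → 0ℚ ≤ w → w ≤ v → ∀ i →
                   v ^ suc i - w ^ suc i ≤ (fromℕ (suc i) * v ^ i) * (v - w)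
  ^-difference-≤ {w} {v} 0≤w w≤v i = begin
    v ^ suc i - w ^ suc i                    ≤⟨ p≤∣p∣ _ ⟩
    ∣ v ^ suc i - w ^ suc i ∣                ≤⟨ ^-lipschitz (ℚ.≤-reflexive (ℚ.0≤p⇒∣p∣≡p (ℚ.≤-trans 0≤w w≤v)))
                                                  (subst (_≤ v) (sym (ℚ.0≤p⇒∣p∣≡p 0≤w)) w≤v) i ⟩
    (fromℕ (suc i) * v ^ i) * ∣ v - w ∣      ≡⟨ cong ((fromℕ (suc i) * v ^ i) *_) (ℚ.0≤p⇒∣p∣≡p (≤⇒0≤- w≤v)) ⟩
    (fromℕ (suc i) * v ^ i) * (v - w)        ∎

  fromℕ-cancel : ∀ i x y → ((fromℕ (suc i) * x) * y) * 1/ℕ (suc i) ≡ y * x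
  fromℕ-cancel i x y = trans
    (solve 4 (λ k x y r → ((k :* x) :* y) :* r := (k :* r) :* (y :* x)) refl (fromℕ (suc i)) x y (1/ℕ (suc i)))
    (trans (cong (_* (y * x)) (fromℕ*1/ℕ (suc i))) (ℚ.*-identityˡ (y * x)))

  -- The derivative of `mercatorTerm i` is the i-th power, so this bound and its counterpart at the
  -- right endpoint sum to geometric series.
  mercatorTerm-difference-≥ : ∀ {w v} → 0ℚ ≤ w → w ≤ v → ∀ i →
                              (v - w) * w ^ i ≤ mercatorTerm i v - mercatorTerm i w
  mercatorTerm-difference-≥ {w} {v} 0≤w w≤v i = subst₂ _≤_
    (fromℕ-cancel i (w ^ i) (v - w))
    (solve 3 (λ a b c → (a :- b) :* c := a :* c :- b :* c) refl (v ^ suc i) (w ^ suc i) (1/ℕ (suc i)))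
    (*-monoʳ-≤ (1/ℕ (suc i)) (ℚ.<⇒≤ (0<1/ℕ (suc i))) (^-difference-≥ 0≤w w≤v i))

  mercatorTerm-difference-≤ : ∀ {w v} → 0ℚ ≤ w → w ≤ v → ∀ i →
                              mercatorTerm i v - mercatorTerm i w ≤ (v - w) * v ^ i
  mercatorTerm-difference-≤ {w} {v} 0≤w w≤v i = subst₂ _≤_
    (solve 3 (λ a b c → (a :- b) :* c := a :* c :- b :* c) refl (v ^ suc i) (w ^ suc i) (1/ℕ (suc i)))
    (fromℕ-cancel i (v ^ i) (v - w))
    (*-monoʳ-≤ (1/ℕ (suc i)) (ℚ.<⇒≤ (0<1/ℕ (suc i))) (^-difference-≤ 0≤w w≤v i))

  -- Transfers the bounds on differences of Mercator terms to exponential terms: up to the factor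
  -- 1/i!, both come from integrating p^i.
  expTerm-suc : ∀ i p → expTerm (suc i) p ≡ mercatorTerm i p * 1/! i
  expTerm-suc i p = trans (cong (p ^ suc i *_) (1/!-suc i)) (sym (ℚ.*-assoc (p ^ suc i) (1/ℕ (suc i)) (1/! i)))

  expTerm-difference-≥ : ∀ {w v} → 0ℚ ≤ w → w ≤ v → ∀ i →
                         expTerm (suc i) w + (v - w) * expTerm i w ≤ expTerm (suc i) v
  expTerm-difference-≥ {w} {v} 0≤w w≤v i = begin
    expTerm (suc i) w + (v - w) * expTerm i w
      ≡⟨ cong (_+ (v - w) * expTerm i w) (expTerm-suc i w) ⟩
    mercatorTerm i w * f + (v - w) * (w ^ i * f)
      ≡⟨ solve 4 (λ m d p f → m :* f :+ d :* (p :* f) := (m :+ d :* p) :* f) refl (mercatorTerm i w) (v - w) (w ^ i) f ⟩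
    (mercatorTerm i w + (v - w) * w ^ i) * f
      ≤⟨ *-monoʳ-≤ f (0≤1/! i) (ℚ.+-monoʳ-≤ (mercatorTerm i w) (mercatorTerm-difference-≥ 0≤w w≤v i)) ⟩
    (mercatorTerm i w + (mercatorTerm i v - mercatorTerm i w)) * f
      ≡⟨ solve 3 (λ a b f → (a :+ (b :- a)) :* f := b :* f) refl (mercatorTerm i w) (mercatorTerm i v) f ⟩
    mercatorTerm i v * f
      ≡⟨ sym (expTerm-suc i v) ⟩
    expTerm (suc i) v ∎
    where f = 1/! i

  expTerm-difference-≤ : ∀ {w v} → 0ℚ ≤ w → w ≤ v → ∀ i →
                         expTerm (suc i) v ≤ expTerm (suc i) w + (v - w) * expTerm i v
  expTerm-difference-≤ {w} {v} 0≤w w≤v i = begin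
    expTerm (suc i) v
      ≡⟨ expTerm-suc i v ⟩
    mercatorTerm i v * f
      ≡⟨ solve 3 (λ a b f → b :* f := (a :+ (b :- a)) :* f) refl (mercatorTerm i w) (mercatorTerm i v) f ⟩
    (mercatorTerm i w + (mercatorTerm i v - mercatorTerm i w)) * f
      ≤⟨ *-monoʳ-≤ f (0≤1/! i) (ℚ.+-monoʳ-≤ (mercatorTerm i w) (mercatorTerm-difference-≤ 0≤w w≤v i)) ⟩
    (mercatorTerm i w + (v - w) * v ^ i) * f
      ≡⟨ solve 4 (λ m d p f → (m :+ d :* p) :* f := m :* f :+ d :* (p :* f)) refl (mercatorTerm i w) (v - w) (v ^ i) f ⟩
    mercatorTerm i w * f + (v - w) * (v ^ i * f)
      ≡⟨ cong (_+ (v - w) * expTerm i v) (sym (expTerm-suc i w)) ⟩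
    expTerm (suc i) w + (v - w) * expTerm i v ∎
    where f = 1/! i

  -- Growth of the partial sums

  expSum : ℕ → ℚ → ℚ
  expSum n p = ∑< n (λ i → expTerm i p)

  mercatorSum : ℕ → ℚ → ℚ
  mercatorSum n p = ∑< n (λ i → mercatorTerm i p)

  0≤expTerm : ∀ {p} → 0ℚ ≤ p → ∀ i → 0ℚ ≤ expTerm i p
  0≤expTerm 0≤p i = 0≤* (0≤^ 0≤p i) (0≤1/! i)

  0≤∑ : ∀ {f} → (∀ i → 0ℚ ≤ f i) → ∀ n → 0ℚ ≤ ∑< n f
  0≤∑ 0≤f zero    = ℚ.≤-refl
  0≤∑ 0≤f (suc n) = 0≤+ (0≤∑ 0≤f n) (0≤f n)

  0≤expSum : ∀ {p} → 0ℚ ≤ p → ∀ n → 0ℚ ≤ expSum n p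
  0≤expSum 0≤p = 0≤∑ (0≤expTerm 0≤p)

  expSum-0 : ∀ n → expSum (suc n) 0ℚ ≡ 1ℚ
  expSum-0 zero    = refl
  expSum-0 (suc n) = trans (cong₂ _+_ (expSum-0 n)
    (trans (cong (_* 1/! (suc n)) (ℚ.*-zeroˡ (0ℚ ^ n))) (ℚ.*-zeroˡ (1/! (suc n))))) (ℚ.+-identityʳ 1ℚ)

  mercatorSum-0 : ∀ n → mercatorSum n 0ℚ ≡ 0ℚ
  mercatorSum-0 zero    = refl
  mercatorSum-0 (suc n) = trans (cong₂ _+_ (mercatorSum-0 n)
    (trans (cong (_* 1/ℕ (suc n)) (ℚ.*-zeroˡ (0ℚ ^ n))) (ℚ.*-zeroˡ (1/ℕ (suc n))))) (ℚ.+-identityʳ 0ℚ)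

  -- The derivative of the sum with n + 1 terms is the sum with n terms, so a lower bound by the
  -- derivative at w costs one term.
  expSum-growth-≥ : ∀ {w v} → 0ℚ ≤ w → w ≤ v → ∀ n →
                    expSum n w * (1ℚ + (v - w)) ≤ expSum (suc n) v
  expSum-growth-≥ {w} {v} 0≤w w≤v n = begin
    expSum n w * (1ℚ + (v - w))
      ≡⟨ solve 2 (λ e d → e :* (con 1ℚ :+ d) := e :+ d :* e) refl (expSum n w) (v - w) ⟩
    expSum n w + (v - w) * expSum n w
      ≤⟨ ℚ.+-monoˡ-≤ ((v - w) * expSum n w) (≤+ {expSum n w} (0≤expTerm 0≤w n)) ⟩
    expSum (suc n) w + (v - w) * expSum n w
      ≤⟨ go n ⟩
    expSum (suc n) v ∎
    where
    go : ∀ n → expSum (suc n) w + (v - w) * expSum n w ≤ expSum (suc n) v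
    go zero    = ℚ.≤-reflexive (trans (cong (expSum 1 w +_) (ℚ.*-zeroʳ (v - w))) (ℚ.+-identityʳ (expSum 1 w)))
    go (suc n) = begin
      (expSum (suc n) w + expTerm (suc n) w) + (v - w) * (expSum n w + expTerm n w)
        ≡⟨ solve 5 (λ a b d e f → (a :+ b) :+ d :* (e :+ f) := (a :+ d :* e) :+ (b :+ d :* f)) refl
             (expSum (suc n) w) (expTerm (suc n) w) (v - w) (expSum n w) (expTerm n w) ⟩
      (expSum (suc n) w + (v - w) * expSum n w) + (expTerm (suc n) w + (v - w) * expTerm n w)
        ≤⟨ ℚ.+-mono-≤ (go n) (expTerm-difference-≥ 0≤w w≤v n) ⟩
      expSum (suc (suc n)) v ∎

  -- Here the derivative at v is the sum with n terms, which is at most the sum with n + 1 terms, so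
  -- the length can stay the same.
  expSum-growth-≤ : ∀ {w v} → 0ℚ ≤ w → w ≤ v → ∀ n →
                    expSum (suc n) v * (1ℚ - (v - w)) ≤ expSum (suc n) w
  expSum-growth-≤ {w} {v} 0≤w w≤v n = begin
    expSum (suc n) v * (1ℚ - (v - w))
      ≡⟨ solve 2 (λ e d → e :* (con 1ℚ :- d) := e :- d :* e) refl (expSum (suc n) v) (v - w) ⟩
    expSum (suc n) v - (v - w) * expSum (suc n) v
      ≤⟨ ℚ.+-mono-≤ (go n) (ℚ.neg-antimono-≤ (*-monoˡ-≤ (v - w) (≤⇒0≤- w≤v) (≤+ (0≤expTerm (ℚ.≤-trans 0≤w w≤v) n)))) ⟩
    (expSum (suc n) w + (v - w) * expSum n v) - (v - w) * expSum n v
      ≡⟨ solve 2 (λ a b → (a :+ b) :- b := a) refl (expSum (suc n) w) ((v - w) * expSum n v) ⟩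
    expSum (suc n) w ∎
    where
    go : ∀ n → expSum (suc n) v ≤ expSum (suc n) w + (v - w) * expSum n v
    go zero    = ℚ.≤-reflexive (sym (trans (cong (expSum 1 w +_) (ℚ.*-zeroʳ (v - w))) (ℚ.+-identityʳ (expSum 1 w))))
    go (suc n) = begin
      expSum (suc n) v + expTerm (suc n) v
        ≤⟨ ℚ.+-mono-≤ (go n) (expTerm-difference-≤ 0≤w w≤v n) ⟩
      (expSum (suc n) w + (v - w) * expSum n v) + (expTerm (suc n) w + (v - w) * expTerm n v)
        ≡⟨ solve 5 (λ a b d e f → (a :+ d :* e) :+ (b :+ d :* f) := (a :+ b) :+ d :* (e :+ f)) refl
             (expSum (suc n) w) (expTerm (suc n) w) (v - w) (expSum n v) (expTerm n v) ⟩
      (expSum (suc n) w + expTerm (suc n) w) + (v - w) * (expSum n v + expTerm n v) ∎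

  mercatorSum-mono : ∀ {w v} → 0ℚ ≤ w → w ≤ v → ∀ n → mercatorSum n w ≤ mercatorSum n v
  mercatorSum-mono 0≤w w≤v zero    = ℚ.≤-refl
  mercatorSum-mono 0≤w w≤v (suc n) = ℚ.+-mono-≤ (mercatorSum-mono 0≤w w≤v n)
    (*-monoʳ-≤ (1/ℕ (suc n)) (ℚ.<⇒≤ (0<1/ℕ (suc n))) (^-mono 0≤w w≤v (suc n)))

  0≤mercatorSum : ∀ {v} → 0ℚ ≤ v → ∀ n → 0ℚ ≤ mercatorSum n v
  0≤mercatorSum {v} 0≤v n = subst (_≤ mercatorSum n v) (mercatorSum-0 n) (mercatorSum-mono ℚ.≤-refl 0≤v n)

  -- The termwise bounds add up to (v - w) times the geometric sum of the powers of v; the factor 1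
  -- - v clears its denominator.
  mercatorSum-growth-≤ : ∀ {w v} → 0ℚ ≤ w → w ≤ v → v ≤ 1ℚ → ∀ n →
                         (mercatorSum n v - mercatorSum n w) * (1ℚ - v) ≤ v - w
  mercatorSum-growth-≤ {w} {v} 0≤w w≤v v≤1 n = begin
    (mercatorSum n v - mercatorSum n w) * (1ℚ - v)
      ≤⟨ go n ⟩
    (v - w) * (1ℚ - v ^ n)
      ≤⟨ *-monoˡ-≤ (v - w) (≤⇒0≤- w≤v) (ℚ.+-monoʳ-≤ 1ℚ (ℚ.neg-antimono-≤ (0≤^ (ℚ.≤-trans 0≤w w≤v) n))) ⟩
    (v - w) * 1ℚ
      ≡⟨ ℚ.*-identityʳ (v - w) ⟩
    v - w ∎
    where
    go : ∀ n → (mercatorSum n v - mercatorSum n w) * (1ℚ - v) ≤ (v - w) * (1ℚ - v ^ n)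
    go zero = ℚ.≤-reflexive (trans (ℚ.*-zeroˡ (1ℚ - v)) (sym (ℚ.*-zeroʳ (v - w))))
    go (suc n) = begin
      ((A + a) - (B + b)) * (1ℚ - v)
        ≡⟨ solve 5 (λ A a B b r → ((A :+ a) :- (B :+ b)) :* r := (A :- B) :* r :+ (a :- b) :* r) refl A a B b (1ℚ - v) ⟩
      (A - B) * (1ℚ - v) + (a - b) * (1ℚ - v)
        ≤⟨ ℚ.+-mono-≤ (go n) (*-monoʳ-≤ (1ℚ - v) (≤⇒0≤- v≤1) (mercatorTerm-difference-≤ 0≤w w≤v n)) ⟩
      (v - w) * (1ℚ - v ^ n) + ((v - w) * v ^ n) * (1ℚ - v)
        ≡⟨ solve 3 (λ d v p → d :* (con 1ℚ :- p) :+ (d :* p) :* (con 1ℚ :- v) := d :* (con 1ℚ :- v :* p)) refl (v - w) v (v ^ n) ⟩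
      (v - w) * (1ℚ - v ^ suc n) ∎
      where
      A = mercatorSum n v
      B = mercatorSum n w
      a = mercatorTerm n v
      b = mercatorTerm n w

  -- The geometric sum is now that of w. Its truncation leaves a defect w^n, which cannot be dropped
  -- in a lower bound and is made up for later by `corrected`.
  mercatorSum-growth-≥ : ∀ {w v} → 0ℚ ≤ w → w ≤ v → w ≤ 1ℚ → ∀ n →
                         (v - w) * (1ℚ - w ^ n) ≤ (mercatorSum n v - mercatorSum n w) * (1ℚ - w)
  mercatorSum-growth-≥ {w} {v} 0≤w w≤v w≤1 zero =
    ℚ.≤-reflexive (trans (ℚ.*-zeroʳ (v - w)) (sym (ℚ.*-zeroˡ (1ℚ - w))))
  mercatorSum-growth-≥ {w} {v} 0≤w w≤v w≤1 (suc n) = begin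
    (v - w) * (1ℚ - w ^ suc n)
      ≡⟨ solve 3 (λ d v p → d :* (con 1ℚ :- v :* p) := d :* (con 1ℚ :- p) :+ (d :* p) :* (con 1ℚ :- v)) refl (v - w) w (w ^ n) ⟩
    (v - w) * (1ℚ - w ^ n) + ((v - w) * w ^ n) * (1ℚ - w)
      ≤⟨ ℚ.+-mono-≤ (mercatorSum-growth-≥ 0≤w w≤v w≤1 n)
           (*-monoʳ-≤ (1ℚ - w) (≤⇒0≤- w≤1) (mercatorTerm-difference-≥ 0≤w w≤v n)) ⟩
    (A - B) * (1ℚ - w) + (a - b) * (1ℚ - w)
      ≡⟨ solve 5 (λ A a B b r → (A :- B) :* r :+ (a :- b) :* r := ((A :+ a) :- (B :+ b)) :* r) refl A a B b (1ℚ - w) ⟩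
    ((A + a) - (B + b)) * (1ℚ - w) ∎
    where
    A = mercatorSum n v
    B = mercatorSum n w
    a = mercatorTerm n v
    b = mercatorTerm n w

  -- Telescoping products along equal steps

  module Steps {δ : ℚ} (0≤δ : 0ℚ ≤ δ) where

    point : ℕ → ℚ
    point m = fromℕ m * δ

    0≤point : ∀ m → 0ℚ ≤ point m
    0≤point m = 0≤* (0≤fromℕ m) 0≤δ

    point-suc : ∀ m → point (suc m) ≡ point m + δ
    point-suc m = trans (cong (_* δ) (fromℕ-suc m))
      (solve 2 (λ k d → (con 1ℚ :+ k) :* d := k :* d :+ d) refl (fromℕ m) δ)

    point-mono : ∀ m → point m ≤ point (suc m)
    point-mono m = *-monoʳ-≤ δ 0≤δ (fromℕ-mono (ℕ.n≤1+n m))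

    gap : ∀ m → point (suc m) - point m ≡ δ
    gap m = trans (cong (_- point m) (point-suc m))
      (solve 2 (λ p d → (p :+ d) :- p := d) refl (point m) δ)

    point-0 : point 0 ≡ 0ℚ
    point-0 = ℚ.*-zeroˡ δ

    -- The left side does not increase from a point w to the next point v: the exponential grows at
    -- most by the factor 1/(1 - Δ), the logarithm's increment satisfies Δ (1 - v) ≤ δ, and 1 - v =
    -- 1 - w - δ restores the same expression at w.
    expSum-mercatorSum-≤ : ∀ n m → point m ≤ 1ℚ →
                           expSum (suc n) (mercatorSum (suc n) (point m)) * (1ℚ - point m - δ) ≤ 1ℚ
    expSum-mercatorSum-≤ n zero _ = begin
      E (point 0) * (1ℚ - point 0 - δ)
        ≡⟨ cong (λ z → E z * (1ℚ - z - δ)) point-0 ⟩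
      E 0ℚ * (1ℚ - 0ℚ - δ)
        ≡⟨ cong (_* (1ℚ - 0ℚ - δ)) (trans (cong (expSum (suc n)) (mercatorSum-0 (suc n))) (expSum-0 n)) ⟩
      1ℚ * (1ℚ - 0ℚ - δ)
        ≡⟨ ℚ.*-identityˡ (1ℚ - 0ℚ - δ) ⟩
      1ℚ - 0ℚ - δ
        ≤⟨ ℚ.+-monoʳ-≤ (1ℚ - 0ℚ) (ℚ.neg-antimono-≤ 0≤δ) ⟩
      1ℚ - 0ℚ - 0ℚ
        ≡⟨ refl ⟩
      1ℚ ∎
      where
      E : ℚ → ℚ
      E z = expSum (suc n) (mercatorSum (suc n) z)
    expSum-mercatorSum-≤ n (suc m) v≤1 = begin
      E v * (1ℚ - v - δ)
        ≤⟨ *-monoˡ-≤ (E v) (0≤expSum (0≤mercatorSum (0≤point (suc m)) (suc n)) (suc n)) shorter ⟩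
      E v * ((1ℚ - Δ) * (1ℚ - v))
        ≡⟨ sym (ℚ.*-assoc (E v) (1ℚ - Δ) (1ℚ - v)) ⟩
      (E v * (1ℚ - Δ)) * (1ℚ - v)
        ≤⟨ *-monoʳ-≤ (1ℚ - v) (≤⇒0≤- v≤1) (expSum-growth-≤ (0≤mercatorSum (0≤point m) (suc n))
             (mercatorSum-mono (0≤point m) (point-mono m) (suc n)) n) ⟩
      E w * (1ℚ - v)
        ≡⟨ cong (E w *_) (trans (cong (λ z → 1ℚ - z) (point-suc m))
             (solve 2 (λ w d → con 1ℚ :- (w :+ d) := con 1ℚ :- w :- d) refl w δ)) ⟩
      E w * (1ℚ - w - δ)
        ≤⟨ expSum-mercatorSum-≤ n m (ℚ.≤-trans (point-mono m) v≤1) ⟩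
      1ℚ ∎
      where
      E : ℚ → ℚ
      E z = expSum (suc n) (mercatorSum (suc n) z)
      w = point m
      v = point (suc m)
      Δ = mercatorSum (suc n) v - mercatorSum (suc n) w
      shorter : 1ℚ - v - δ ≤ (1ℚ - Δ) * (1ℚ - v)
      shorter = begin
        1ℚ - v - δ
          ≤⟨ ℚ.+-monoʳ-≤ (1ℚ - v) (ℚ.neg-antimono-≤ (subst (Δ * (1ℚ - v) ≤_) (gap m)
               (mercatorSum-growth-≤ (0≤point m) (point-mono m) v≤1 (suc n)))) ⟩
        1ℚ - v - Δ * (1ℚ - v)
          ≡⟨ solve 2 (λ v d → con 1ℚ :- v :- d :* (con 1ℚ :- v) := (con 1ℚ :- d) :* (con 1ℚ :- v)) refl v Δ ⟩
        (1ℚ - Δ) * (1ℚ - v) ∎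

    module _ {s : ℚ} (0≤s : 0ℚ ≤ s) (k : ℕ) where

      -- The correction s vᵏ⁺¹ compensates the truncation of the series, so
      -- that increments are bounded below exactly as for the full logarithm.
      corrected : ℚ → ℚ
      corrected v = mercatorSum k v + s * v ^ suc k

      corrected-0 : corrected 0ℚ ≡ 0ℚ
      corrected-0 = trans (cong₂ _+_ (mercatorSum-0 k)
        (trans (cong (s *_) (ℚ.*-zeroˡ (0ℚ ^ k))) (ℚ.*-zeroʳ s))) (ℚ.+-identityʳ 0ℚ)

      corrected-mono : ∀ {w v} → 0ℚ ≤ w → w ≤ v → corrected w ≤ corrected v
      corrected-mono 0≤w w≤v =
        ℚ.+-mono-≤ (mercatorSum-mono 0≤w w≤v k) (*-monoˡ-≤ s 0≤s (^-mono 0≤w w≤v (suc k)))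

      0≤corrected : ∀ {v} → 0ℚ ≤ v → 0ℚ ≤ corrected v
      0≤corrected {v} 0≤v = subst (_≤ corrected v) corrected-0 (corrected-mono ℚ.≤-refl 0≤v)

      -- The truncated geometric sum falls short by (v - w) w^k. The increment of the correction is
      -- at least s (v - w) w^k, and s (1 - w) ≥ 1 makes this cover the gap.
      corrected-growth : ∀ {w v} → 0ℚ ≤ w → w ≤ v → w ≤ 1ℚ → 1ℚ ≤ s * (1ℚ - w) →
                         v - w ≤ (corrected v - corrected w) * (1ℚ - w)
      corrected-growth {w} {v} 0≤w w≤v w≤1 1≤s[1-w] = begin
        v - w
          ≡⟨ solve 2 (λ d p → d := d :* (con 1ℚ :- p) :+ (d :* p) :* con 1ℚ) refl (v - w) (w ^ k) ⟩
        (v - w) * (1ℚ - w ^ k) + ((v - w) * w ^ k) * 1ℚ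
          ≤⟨ ℚ.+-mono-≤ (mercatorSum-growth-≥ 0≤w w≤v w≤1 k)
               (*-mono-≤ (0≤* (≤⇒0≤- w≤v) (0≤^ 0≤w k)) (ℚ.≤-trans 0≤1 1≤s[1-w]) powers 1≤s[1-w]) ⟩
        (A - B) * (1ℚ - w) + (v ^ suc k - w ^ suc k) * (s * (1ℚ - w))
          ≡⟨ solve 6 (λ A B a b s r → (A :- B) :* r :+ (a :- b) :* (s :* r) := ((A :+ s :* a) :- (B :+ s :* b)) :* r)
               refl A B (v ^ suc k) (w ^ suc k) s (1ℚ - w) ⟩
        (corrected v - corrected w) * (1ℚ - w) ∎
        where
        A = mercatorSum k v
        B = mercatorSum k w
        powers : (v - w) * w ^ k ≤ v ^ suc k - w ^ suc k
        powers = begin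
          (v - w) * w ^ k          ≡⟨ solve 3 (λ v w p → (v :- w) :* p := v :* p :- w :* p) refl v w (w ^ k) ⟩
          v * w ^ k - w * w ^ k    ≤⟨ ℚ.+-monoˡ-≤ (- (w * w ^ k)) (*-monoˡ-≤ v (ℚ.≤-trans 0≤w w≤v) (^-mono 0≤w w≤v k)) ⟩
          v * v ^ k - w * w ^ k    ∎

      -- Each step applies `expSum-growth-≥` and so adds one term: after m steps the exponential sum
      -- has m + 1 terms, while the truncation k of the logarithm stays fixed. Since 1 - w = 1 - v +
      -- δ, a step reproduces the same expression at the next point.
      expSum-corrected-≥ : ∀ m → point m ≤ 1ℚ → 1ℚ ≤ s * (1ℚ - point m) →
                           1ℚ ≤ expSum (suc m) (corrected (point m)) * (1ℚ - point m + δ)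
      expSum-corrected-≥ zero _ _ = begin
        1ℚ
          ≤⟨ ≤+ 0≤δ ⟩
        1ℚ - 0ℚ + δ
          ≡⟨ sym (ℚ.*-identityˡ (1ℚ - 0ℚ + δ)) ⟩
        1ℚ * (1ℚ - 0ℚ + δ)
          ≡⟨ cong (λ z → expSum 1 z * (1ℚ - 0ℚ + δ)) (sym corrected-0) ⟩
        expSum 1 (corrected 0ℚ) * (1ℚ - 0ℚ + δ)
          ≡⟨ cong (λ z → expSum 1 (corrected z) * (1ℚ - z + δ)) (sym point-0) ⟩
        expSum 1 (corrected (point 0)) * (1ℚ - point 0 + δ) ∎
      expSum-corrected-≥ (suc m) v≤1 1≤s[1-v] = begin
        1ℚ
          ≤⟨ expSum-corrected-≥ m w≤1 1≤s[1-w] ⟩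
        E * (1ℚ - w + δ)
          ≤⟨ *-monoˡ-≤ E (0≤expSum (0≤corrected (0≤point m)) (suc m)) (ℚ.+-monoʳ-≤ (1ℚ - w)
               (subst (_≤ Δ * (1ℚ - w)) (gap m) (corrected-growth (0≤point m) (point-mono m) w≤1 1≤s[1-w]))) ⟩
        E * (1ℚ - w + Δ * (1ℚ - w))
          ≡⟨ solve 3 (λ e r d → e :* (r :+ d :* r) := (e :* (con 1ℚ :+ d)) :* r) refl E (1ℚ - w) Δ ⟩
        (E * (1ℚ + Δ)) * (1ℚ - w)
          ≤⟨ *-monoʳ-≤ (1ℚ - w) (≤⇒0≤- w≤1) (expSum-growth-≥ (0≤corrected (0≤point m))
               (corrected-mono (0≤point m) (point-mono m)) (suc m)) ⟩
        expSum (suc (suc m)) (corrected v) * (1ℚ - w)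
          ≡⟨ cong (expSum (suc (suc m)) (corrected v) *_) (trans
               (solve 2 (λ w d → con 1ℚ :- w := con 1ℚ :- (w :+ d) :+ d) refl w δ)
               (cong (λ z → 1ℚ - z + δ) (sym (point-suc m)))) ⟩
        expSum (suc (suc m)) (corrected v) * (1ℚ - v + δ) ∎
        where
        w = point m
        v = point (suc m)
        Δ = corrected v - corrected w
        E = expSum (suc m) (corrected w)
        w≤1 = ℚ.≤-trans (point-mono m) v≤1
        1≤s[1-w] = ℚ.≤-trans 1≤s[1-v] (*-monoˡ-≤ s 0≤s (ℚ.+-monoʳ-≤ 1ℚ (ℚ.neg-antimono-≤ (point-mono m))))

  equal-steps : ∀ u m → fromℕ (suc m) * (u * 1/ℕ (suc m)) ≡ u
  equal-steps u m = trans
    (solve 3 (λ k u i → k :* (u :* i) := u :* (k :* i)) refl (fromℕ (suc m)) u (1/ℕ (suc m)))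
    (trans (cong (u *_) (fromℕ*1/ℕ (suc m))) (ℚ.*-identityʳ u))

  module _ {u : ℚ} (0≤u : 0ℚ ≤ u) (u≤1 : u ≤ 1ℚ) (m : ℕ) where

    private
      -- The step is δ, and m + 1 steps reach u. The bound κ on δ does not depend on u, so the error
      -- becomes an explicit null sequence.
      κ = 1/ℕ (suc m)
      δ = u * κ
      0≤κ = ℚ.<⇒≤ (0<1/ℕ (suc m))
      0≤δ = 0≤* 0≤u 0≤κ
      δ≤κ : δ ≤ κ
      δ≤κ = subst (δ ≤_) (ℚ.*-identityˡ κ) (*-monoʳ-≤ κ 0≤κ u≤1)
      point≤1 = subst (_≤ 1ℚ) (sym (equal-steps u m)) u≤1

    exp-mercator-≤ : expSum (suc (suc m)) (mercatorSum (suc (suc m)) u) * (1ℚ - u - κ) ≤ 1ℚ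
    exp-mercator-≤ = begin
      E u * (1ℚ - u - κ)
        ≤⟨ *-monoˡ-≤ (E u) (0≤expSum (0≤mercatorSum 0≤u (suc (suc m))) (suc (suc m)))
             (ℚ.+-monoʳ-≤ (1ℚ - u) (ℚ.neg-antimono-≤ δ≤κ)) ⟩
      E u * (1ℚ - u - δ)
        ≡⟨ cong (λ z → E z * (1ℚ - z - δ)) (sym (equal-steps u m)) ⟩
      E (fromℕ (suc m) * δ) * (1ℚ - fromℕ (suc m) * δ - δ)
        ≤⟨ Steps.expSum-mercatorSum-≤ 0≤δ (suc m) (suc m) point≤1 ⟩
      1ℚ ∎
      where
      E : ℚ → ℚ
      E z = expSum (suc (suc m)) (mercatorSum (suc (suc m)) z)

    exp-mercator-≥ : ∀ {s} → 0ℚ ≤ s → 1ℚ ≤ s * (1ℚ - u) → ∀ k →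
                     1ℚ ≤ expSum (suc (suc m)) (mercatorSum k u + s * u ^ suc k) * (1ℚ - u + κ)
    exp-mercator-≥ {s} 0≤s 1≤s[1-u] k = begin
      1ℚ
        ≤⟨ Steps.expSum-corrected-≥ 0≤δ 0≤s k (suc m) point≤1
             (subst (λ z → 1ℚ ≤ s * (1ℚ - z)) (sym (equal-steps u m)) 1≤s[1-u]) ⟩
      E (fromℕ (suc m) * δ) * (1ℚ - fromℕ (suc m) * δ + δ)
        ≡⟨ cong (λ z → E z * (1ℚ - z + δ)) (equal-steps u m) ⟩
      E u * (1ℚ - u + δ)
        ≤⟨ *-monoˡ-≤ (E u) (0≤expSum (0≤+ (0≤mercatorSum 0≤u k) (0≤* 0≤s (0≤^ 0≤u (suc k)))) (suc (suc m)))
             (ℚ.+-monoʳ-≤ (1ℚ - u) δ≤κ) ⟩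
      E u * (1ℚ - u + κ) ∎
      where
      E : ℚ → ℚ
      E z = expSum (suc (suc m)) (mercatorSum k z + s * z ^ suc k)

-- Finite sums and the multiplicativity of exponential partial sums

module ExponentialSums where

  open Defs.RationalLemmas
  open RationalEstimates
  open Data.Rational.Base using (_+_; _*_; -_; _-_; ∣_∣; _≤_)
  open RawSemiringDefs ℚ.+-*-rawSemiring using (_^_; sum) renaming (_×_ to _·_)
  open +-*-Solver using (solve; _:+_; _:*_; _:-_; _:=_; con)
  open ℚ.≤-Reasoning
  private module Sum = SemiringSum (CommutativeRing.semiring ℚ.+-*-commutativeRing)

  -- `sum` splits off the first term and `∑<` the last one, hence the passage through
  -- `sum-init-last`.
  sum-toℕ : ∀ n f → sum {n} (λ i → f (toℕ i)) ≡ ∑< n f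
  sum-toℕ zero    f = refl
  sum-toℕ (suc n) f = begin-equality
    sum {suc n} (λ i → f (toℕ i))
      ≡⟨ Sum.sum-init-last {n} (λ i → f (toℕ i)) ⟩
    sum {n} (λ i → f (toℕ (Fin.inject₁ i))) + f (toℕ (Fin.fromℕ n))
      ≡⟨ cong₂ _+_ (trans (Sum.sum-cong-≗ {n} (λ i → cong f (Fin.toℕ-inject₁ i))) (sum-toℕ n f))
                   (cong f (Fin.toℕ-fromℕ n)) ⟩
    ∑< n f + f n ∎

  ∑-cong : ∀ {f g} n → (∀ i → i ℕ.< n → f i ≡ g i) → ∑< n f ≡ ∑< n g
  ∑-cong zero    h = refl
  ∑-cong (suc n) h = cong₂ _+_ (∑-cong n (λ i i<n → h i (ℕ.m<n⇒m<1+n i<n))) (h n (ℕ.n<1+n n))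

  ∑-+ : ∀ f g n → ∑< n (λ i → f i + g i) ≡ ∑< n f + ∑< n g
  ∑-+ f g zero    = refl
  ∑-+ f g (suc n) = trans (cong (_+ (f n + g n)) (∑-+ f g n))
    (solve 4 (λ a b c d → (a :+ b) :+ (c :+ d) := (a :+ c) :+ (b :+ d)) refl (∑< n f) (∑< n g) (f n) (g n))

  ∑-*ʳ : ∀ f c n → ∑< n f * c ≡ ∑< n (λ i → f i * c)
  ∑-*ʳ f c zero    = ℚ.*-zeroˡ c
  ∑-*ʳ f c (suc n) = trans (ℚ.*-distribʳ-+ c (∑< n f) (f n)) (cong (_+ f n * c) (∑-*ʳ f c n))

  ∑-mono : ∀ {f g} n → (∀ i → i ℕ.< n → f i ≤ g i) → ∑< n f ≤ ∑< n g
  ∑-mono zero    h = ℚ.≤-refl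
  ∑-mono (suc n) h = ℚ.+-mono-≤ (∑-mono n (λ i i<n → h i (ℕ.m<n⇒m<1+n i<n))) (h n (ℕ.n<1+n n))

  ∣∑∣≤∑ : ∀ {f g} → (∀ i → ∣ f i ∣ ≤ g i) → ∀ n → ∣ ∑< n f ∣ ≤ ∑< n g
  ∣∑∣≤∑ h zero    = ℚ.≤-refl
  ∣∑∣≤∑ {f} h (suc n) = ℚ.≤-trans (ℚ.∣p+q∣≤∣p∣+∣q∣ (∑< n f) (f n)) (ℚ.+-mono-≤ (∣∑∣≤∑ h n) (h n))

  ∣∑-∑∣≤ : ∀ {f g m n} → (∀ i → ∣ f i ∣ ≤ g i) → m ℕ.≤ n → ∣ ∑< n f - ∑< m f ∣ ≤ ∑< n g - ∑< m g
  ∣∑-∑∣≤ {f} {g} {m} {n} h m≤n =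
    subst (λ k → ∣ ∑< k f - ∑< m f ∣ ≤ ∑< k g - ∑< m g) (ℕ.m∸n+n≡m m≤n) (∑-tail f g h m (n ∸ m))

  ∑-mono-length : ∀ {f m n} → (∀ i → 0ℚ ≤ f i) → m ℕ.≤ n → ∑< m f ≤ ∑< n f
  ∑-mono-length 0≤f m≤n = 0≤-⇒≤
    (ℚ.≤-trans (ℚ.0≤∣p∣ _) (∣∑-∑∣≤ (λ i → ℚ.≤-reflexive (ℚ.0≤p⇒∣p∣≡p (0≤f i))) m≤n))

  fromℕ-+ : ∀ m n → fromℕ (m ℕ.+ n) ≡ fromℕ m + fromℕ n
  fromℕ-+ zero    n = sym (ℚ.+-identityˡ (fromℕ n))
  fromℕ-+ (suc m) n = begin-equality
    fromℕ (suc (m ℕ.+ n))      ≡⟨ fromℕ-suc (m ℕ.+ n) ⟩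
    1ℚ + fromℕ (m ℕ.+ n)       ≡⟨ cong (1ℚ +_) (fromℕ-+ m n) ⟩
    1ℚ + (fromℕ m + fromℕ n)   ≡⟨ sym (ℚ.+-assoc 1ℚ (fromℕ m) (fromℕ n)) ⟩
    (1ℚ + fromℕ m) + fromℕ n   ≡⟨ cong (_+ fromℕ n) (sym (fromℕ-suc m)) ⟩
    fromℕ (suc m) + fromℕ n    ∎

  ·≡fromℕ* : ∀ m p → m · p ≡ fromℕ m * p
  ·≡fromℕ* zero    p = sym (ℚ.*-zeroˡ p)
  ·≡fromℕ* (suc m) p = begin-equality
    p + m · p             ≡⟨ cong (p +_) (·≡fromℕ* m p) ⟩
    p + fromℕ m * p       ≡⟨ solve 2 (λ k p → p :+ k :* p := (con 1ℚ :+ k) :* p) refl (fromℕ m) p ⟩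
    (1ℚ + fromℕ m) * p    ≡⟨ cong (_* p) (sym (fromℕ-suc m)) ⟩
    fromℕ (suc m) * p     ∎

  fromℕ-* : ∀ m n → fromℕ (m ℕ.* n) ≡ fromℕ m * fromℕ n
  fromℕ-* zero    n = sym (ℚ.*-zeroˡ (fromℕ n))
  fromℕ-* (suc m) n = begin-equality
    fromℕ (n ℕ.+ m ℕ.* n)           ≡⟨ fromℕ-+ n (m ℕ.* n) ⟩
    fromℕ n + fromℕ (m ℕ.* n)       ≡⟨ cong (fromℕ n +_) (fromℕ-* m n) ⟩
    fromℕ n + fromℕ m * fromℕ n     ≡⟨ solve 2 (λ k p → p :+ k :* p := (con 1ℚ :+ k) :* p) refl (fromℕ m) (fromℕ n) ⟩
    (1ℚ + fromℕ m) * fromℕ n        ≡⟨ cong (_* fromℕ n) (sym (fromℕ-suc m)) ⟩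
    fromℕ (suc m) * fromℕ n         ∎

  fromℕ!*1/! : ∀ n → fromℕ (n !) * 1/! n ≡ 1ℚ
  fromℕ!*1/! n = fromℕ*1/ℕ (n !) {{ℕ._!≢0 n}}

  C*1/! : ∀ {n k} → k ℕ.≤ n → fromℕ (n C k) * 1/! n ≡ 1/! k * 1/! (n ∸ k)
  C*1/! {n} {k} k≤n = begin-equality
    c * 1/! n
      -- The inserted factors 1 become k! / k! and (n - k)! / (n - k)!, whose numerators then cancel
      -- the binomial coefficient against n!.
      ≡⟨ solve 2 (λ c i → c :* i := (c :* i) :* (con 1ℚ :* con 1ℚ)) refl c (1/! n) ⟩
    (c * 1/! n) * (1ℚ * 1ℚ)
      ≡⟨ cong ((c * 1/! n) *_) (sym (cong₂ _*_ (fromℕ!*1/! k) (fromℕ!*1/! (n ∸ k)))) ⟩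
    (c * 1/! n) * ((F k * 1/! k) * (F (n ∸ k) * 1/! (n ∸ k)))
      ≡⟨ solve 6 (λ c i a b d e → (c :* i) :* ((a :* b) :* (d :* e)) := ((c :* (a :* d)) :* i) :* (b :* e)) refl
           c (1/! n) (F k) (1/! k) (F (n ∸ k)) (1/! (n ∸ k)) ⟩
    ((c * (F k * F (n ∸ k))) * 1/! n) * (1/! k * 1/! (n ∸ k))
      ≡⟨ cong (λ z → (z * 1/! n) * (1/! k * 1/! (n ∸ k))) factorials ⟩
    (F n * 1/! n) * (1/! k * 1/! (n ∸ k))
      ≡⟨ cong (_* (1/! k * 1/! (n ∸ k))) (fromℕ!*1/! n) ⟩
    1ℚ * (1/! k * 1/! (n ∸ k))
      ≡⟨ ℚ.*-identityˡ _ ⟩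
    1/! k * 1/! (n ∸ k) ∎
    where
    F : ℕ → ℚ
    F m = fromℕ (m !)
    c = fromℕ (n C k)
    instance _ = ℕ._!*_!≢0 k (n ∸ k)
    factorials : c * (F k * F (n ∸ k)) ≡ F n
    factorials = begin-equality
      c * (F k * F (n ∸ k))                 ≡⟨ cong (c *_) (sym (fromℕ-* (k !) ((n ∸ k) !))) ⟩
      c * fromℕ (k ! ℕ.* (n ∸ k) !)         ≡⟨ sym (fromℕ-* (n C k) (k ! ℕ.* (n ∸ k) !)) ⟩
      fromℕ ((n C k) ℕ.* (k ! ℕ.* (n ∸ k) !)) ≡⟨ cong (λ z → fromℕ (z ℕ.* (k ! ℕ.* (n ∸ k) !))) (nCk≡n!/k![n-k]! k≤n) ⟩
      fromℕ (n ! ℕ./ (k ! ℕ.* (n ∸ k) !) ℕ.* (k ! ℕ.* (n ∸ k) !)) ≡⟨ cong fromℕ (ℕ.m/n*n≡m (k![n∸k]!∣n! k≤n)) ⟩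
      F n                                   ∎

  -- The binomial theorem divided by n!. It serves both the addition theorem for exp and the
  -- summation of the q-Bernstein polynomials.
  expTerm-+ : ∀ a b n → sum {suc n} (λ i → expTerm (toℕ i) a * expTerm (n ∸ toℕ i) b) ≡ expTerm n (a + b)
  expTerm-+ a b n = sym (begin-equality
    (a + b) ^ n * 1/! n
      ≡⟨ cong (_* 1/! n) (Binomial.theorem (CommutativeRing.commutativeSemiring ℚ.+-*-commutativeRing) n a b) ⟩
    sum {suc n} (λ i → (n C toℕ i) · (a ^ toℕ i * b ^ (n ∸ toℕ i))) * 1/! n
      ≡⟨ Sum.*-distribʳ-sum {suc n} (1/! n) (λ i → (n C toℕ i) · (a ^ toℕ i * b ^ (n ∸ toℕ i))) ⟩
    sum {suc n} (λ i → ((n C toℕ i) · (a ^ toℕ i * b ^ (n ∸ toℕ i))) * 1/! n)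
      ≡⟨ Sum.sum-cong-≗ {suc n} (λ i → term (toℕ i) (Fin.toℕ≤pred[n] i)) ⟩
    sum {suc n} (λ i → expTerm (toℕ i) a * expTerm (n ∸ toℕ i) b) ∎)
    where
    term : ∀ k → k ℕ.≤ n → ((n C k) · (a ^ k * b ^ (n ∸ k))) * 1/! n ≡ expTerm k a * expTerm (n ∸ k) b
    term k k≤n = begin-equality
      ((n C k) · (p * r)) * 1/! n
        ≡⟨ cong (_* 1/! n) (·≡fromℕ* (n C k) (p * r)) ⟩
      (fromℕ (n C k) * (p * r)) * 1/! n
        ≡⟨ solve 3 (λ c z i → (c :* z) :* i := z :* (c :* i)) refl (fromℕ (n C k)) (p * r) (1/! n) ⟩
      (p * r) * (fromℕ (n C k) * 1/! n)
        ≡⟨ cong ((p * r) *_) (C*1/! k≤n) ⟩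
      (p * r) * (1/! k * 1/! (n ∸ k))
        ≡⟨ solve 4 (λ a b c d → (a :* b) :* (c :* d) := (a :* c) :* (b :* d)) refl p r (1/! k) (1/! (n ∸ k)) ⟩
      (p * 1/! k) * (r * 1/! (n ∸ k)) ∎
      where
      p = a ^ k
      r = b ^ (n ∸ k)

  -- Sums the triangle i + j < n by rows; passing from n to n + 1 adds the antidiagonal i + j = n,
  -- which is `expTerm-+`.
  expSum-+ : ∀ a b n → expSum n (a + b) ≡ ∑< n (λ i → expTerm i a * expSum (n ∸ i) b)
  expSum-+ a b zero    = refl
  expSum-+ a b (suc n) = begin-equality
    expSum n (a + b) + expTerm n (a + b)
      ≡⟨ cong₂ _+_ widened (trans (sym (expTerm-+ a b n)) (sum-toℕ (suc n) (λ i → expTerm i a * expTerm (n ∸ i) b))) ⟩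
    ∑< (suc n) (λ i → expTerm i a * expSum (n ∸ i) b) + ∑< (suc n) (λ i → expTerm i a * expTerm (n ∸ i) b)
      ≡⟨ sym (∑-+ _ _ (suc n)) ⟩
    ∑< (suc n) (λ i → expTerm i a * expSum (n ∸ i) b + expTerm i a * expTerm (n ∸ i) b)
      ≡⟨ ∑-cong (suc n) (λ i i<1+n → trans
           (sym (ℚ.*-distribˡ-+ (expTerm i a) (expSum (n ∸ i) b) (expTerm (n ∸ i) b)))
           (cong (λ k → expTerm i a * expSum k b) (sym (ℕ.+-∸-assoc 1 (ℕ.s≤s⁻¹ i<1+n))))) ⟩
    ∑< (suc n) (λ i → expTerm i a * expSum (suc n ∸ i) b) ∎
    where
    -- The added row i = n is empty; it makes the range agree with that of the antidiagonal.
    widened : expSum n (a + b) ≡ ∑< (suc n) (λ i → expTerm i a * expSum (n ∸ i) b)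
    widened = begin-equality
      expSum n (a + b)
        ≡⟨ expSum-+ a b n ⟩
      ∑< n (λ i → expTerm i a * expSum (n ∸ i) b)
        ≡⟨ sym (ℚ.+-identityʳ _) ⟩
      ∑< n (λ i → expTerm i a * expSum (n ∸ i) b) + 0ℚ
        ≡⟨ cong (∑< n (λ i → expTerm i a * expSum (n ∸ i) b) +_) (sym (trans (cong (λ k → expTerm n a * expSum k b) (ℕ.n∸n≡0 n)) (ℚ.*-zeroʳ (expTerm n a)))) ⟩
      ∑< n (λ i → expTerm i a * expSum (n ∸ i) b) + expTerm n a * expSum (n ∸ n) b ∎

  -- The square i, j < n without the triangle i + j < n: row i keeps the terms with n - i ≤ j < n.
  expSum-defect : ∀ a b n → expSum n a * expSum n b - expSum n (a + b) ≡
                  ∑< n (λ i → expTerm i a * (expSum n b - expSum (n ∸ i) b))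
  expSum-defect a b n = begin-equality
    expSum n a * expSum n b - expSum n (a + b)
      ≡⟨ cong₂ _-_ (trans (∑-*ʳ (λ i → expTerm i a) (expSum n b) n) split) (expSum-+ a b n) ⟩
    (X + Y) - Y
      ≡⟨ solve 2 (λ x y → (x :+ y) :- y := x) refl X Y ⟩
    X ∎
    where
    X = ∑< n (λ i → expTerm i a * (expSum n b - expSum (n ∸ i) b))
    Y = ∑< n (λ i → expTerm i a * expSum (n ∸ i) b)
    split : ∑< n (λ i → expTerm i a * expSum n b) ≡ X + Y
    split = trans
      (∑-cong n (λ i _ → solve 3 (λ t e f → t :* e := t :* (e :- f) :+ t :* f) refl
        (expTerm i a) (expSum n b) (expSum (n ∸ i) b)))
      (∑-+ _ _ n)

  ∣expTerm∣≤ : ∀ {p r} → ∣ p ∣ ≤ r → ∀ i → ∣ expTerm i p ∣ ≤ expTerm i r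
  ∣expTerm∣≤ {p} h i = scaled-size {p ^ i} (1/! i) (0≤1/! i) (∣^∣≤ h i)

  -- The defect of multiplicativity is a sum of monomials with non-negative
  -- coefficients, so it is largest at (r , r), where it is a tail of the
  -- series for exp (r + r).
  ∣expSum-defect∣≤ : ∀ {a b r} → ∣ a ∣ ≤ r → ∣ b ∣ ≤ r → ∀ n →
    ∣ expSum n a * expSum n b - expSum n (a + b) ∣ ≤ expSum (n ℕ.+ n) (r + r) - expSum n (r + r)
  ∣expSum-defect∣≤ {a} {b} {r} ha hb n = begin
    ∣ expSum n a * expSum n b - expSum n (a + b) ∣
      ≡⟨ cong ∣_∣ (expSum-defect a b n) ⟩
    ∣ ∑< n (λ i → expTerm i a * (expSum n b - expSum (n ∸ i) b)) ∣
      ≤⟨ ∣∑∣≤∑ termwise n ⟩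
    ∑< n (λ i → expTerm i r * (expSum n r - expSum (n ∸ i) r))
      ≡⟨ sym (expSum-defect r r n) ⟩
    expSum n r * expSum n r - expSum n (r + r)
      ≤⟨ ℚ.+-monoˡ-≤ (- expSum n (r + r)) square≤triangle ⟩
    expSum (n ℕ.+ n) (r + r) - expSum n (r + r) ∎
    where
    0≤r = ℚ.≤-trans (ℚ.0≤∣p∣ a) ha
    termwise : ∀ i → ∣ expTerm i a * (expSum n b - expSum (n ∸ i) b) ∣ ≤ expTerm i r * (expSum n r - expSum (n ∸ i) r)
    termwise i = subst (_≤ expTerm i r * (expSum n r - expSum (n ∸ i) r))
      (sym (ℚ.∣p*q∣≡∣p∣*∣q∣ (expTerm i a) (expSum n b - expSum (n ∸ i) b)))
      (*-mono-≤ (ℚ.0≤∣p∣ _) (ℚ.≤-trans (ℚ.0≤∣p∣ _) tails) (∣expTerm∣≤ ha i) tails)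
      where tails = ∣∑-∑∣≤ (∣expTerm∣≤ hb) (ℕ.m∸n≤m n i)
    -- The square i, j < n lies inside the triangle i + j < n + n, and all terms are non-negative.
    square≤triangle : expSum n r * expSum n r ≤ expSum (n ℕ.+ n) (r + r)
    square≤triangle = begin
      expSum n r * expSum n r
        ≡⟨ ∑-*ʳ (λ i → expTerm i r) (expSum n r) n ⟩
      ∑< n (λ i → expTerm i r * expSum n r)
        ≤⟨ ∑-mono n (λ i i<n → *-monoˡ-≤ (expTerm i r) (0≤expTerm 0≤r i) (∑-mono-length (0≤expTerm 0≤r)
             (subst (n ℕ.≤_) (sym (ℕ.+-∸-assoc n (ℕ.<⇒≤ i<n))) (ℕ.m≤m+n n (n ∸ i))))) ⟩
      ∑< n (λ i → expTerm i r * expSum (n ℕ.+ n ∸ i) r)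
        ≤⟨ ∑-mono-length (λ i → 0≤* (0≤expTerm 0≤r i) (0≤expSum 0≤r (n ℕ.+ n ∸ i))) (ℕ.m≤m+n n n) ⟩
      ∑< (n ℕ.+ n) (λ i → expTerm i r * expSum (n ℕ.+ n ∸ i) r)
        ≡⟨ sym (expSum-+ r r (n ℕ.+ n)) ⟩
      expSum (n ℕ.+ n) (r + r) ∎

-- The exponential function and inverses on the reals

open import Defs
open Defs.RationalLemmas
open RationalEstimates using (expSum; mercatorSum; expSum-0; 0≤∑; ^-mono; exp-mercator-≤; exp-mercator-≥)
open ExponentialSums using (expTerm-+; ∣expSum-defect∣≤; fromℕ!*1/!)
open +-*-Solver using (solve; _:+_; _:*_; _:-_; :-_; _:=_; con)
module ℚ-Powers = RawSemiringDefs ℚ.+-*-rawSemiring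
module ℚ-Sum = SemiringSum (CommutativeRing.semiring ℚ.+-*-commutativeRing)
module ℝ-Exp = SemiringExp (CommutativeRing.semiring ℝ-commutativeRing)
module ℝ-Reasoning = SetoidReasoning (CommutativeRing.setoid ℝ-commutativeRing)

-- The bound has the form `K + 1ℚ` because this is the radius of the ball in `ExpBound K`.
common-bound : ∀ x y → ∃ λ K → 0ℚ ℚ.< K × ∃ λ N → ∀ n → N ℕ.≤ n →
               ℚ.∣ seq x n ∣ ℚ.≤ K ℚ.+ 1ℚ × ℚ.∣ seq y n ∣ ℚ.≤ K ℚ.+ 1ℚ
common-bound x y =
  let (K , 0<K , N , b)    = Cauchy⇒bounded {seq x} (cauchy x)
      (L , 0<L , N′ , b′) = Cauchy⇒bounded {seq y} (cauchy y)
  in K ℚ.+ L , ℚ.+-mono-< 0<K 0<L , N ℕ.⊔ N′ , λ n Nn →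
    ℚ.≤-trans (b n (l⊔ N N′ Nn)) (ℚ.≤-trans (≤+ (ℚ.<⇒≤ 0<L)) (≤+ 0≤1)) ,
    ℚ.≤-trans (b′ n (r⊔ N N′ Nn)) (ℚ.≤-trans
      (subst (L ℚ.≤_) (ℚ.+-comm L K) (≤+ (ℚ.<⇒≤ 0<K))) (≤+ 0≤1))

-- On a ball the n-th partial sum is Lipschitz with constant `∑< n M`. A bound L for these constants
-- valid for all large n leads to the tolerance `shrink L ε`.
exp-cong : ∀ {x y} → x ≈ y → exp x ≈ exp y
exp-cong {x} {y} x≈y ε 0<ε =
  let (K , 0<K , N , b)    = common-bound x y
      (L , 0<L , N′ , b′) = Cauchy⇒bounded (ExpBound.sums-cauchy K 0<K)
      (N″ , close)         = x≈y (shrink L ε) (0<shrink 0<L 0<ε)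
  in N ℕ.⊔ (N′ ℕ.⊔ N″) , λ n Nn →
    bound K 0<K L 0<L n (b n (l⊔ N (N′ ℕ.⊔ N″) Nn))
      (b′ n (l⊔ N′ N″ (r⊔ N (N′ ℕ.⊔ N″) Nn))) (close n (r⊔ N′ N″ (r⊔ N (N′ ℕ.⊔ N″) Nn)))
  where
  open ℚ.≤-Reasoning
  bound : ∀ K 0<K L → 0ℚ ℚ.< L → ∀ n →
          ℚ.∣ seq x n ∣ ℚ.≤ K ℚ.+ 1ℚ × ℚ.∣ seq y n ∣ ℚ.≤ K ℚ.+ 1ℚ →
          ℚ.∣ ∑< n (ExpBound.M K 0<K) ∣ ℚ.≤ L → ℚ.∣ seq x n ℚ.- seq y n ∣ ℚ.≤ shrink L ε →
          ℚ.∣ expSum n (seq x n) ℚ.- expSum n (seq y n) ∣ ℚ.≤ ε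
  bound K 0<K L 0<L n (bx , by) ∑M≤L close = begin
    ℚ.∣ expSum n (seq x n) ℚ.- expSum n (seq y n) ∣
      ≤⟨ ∑-distance (λ i → expTerm i (seq x n)) (λ i → expTerm i (seq y n)) M D (λ i → lip i (seq x n) (seq y n) bx by) n ⟩
    ∑< n M ℚ.* D
      ≤⟨ *-mono-≤ (0≤∑ 0≤M n) (ℚ.<⇒≤ (0<shrink 0<L 0<ε)) (ℚ.≤-trans (p≤∣p∣ (∑< n M)) ∑M≤L) close ⟩
    L ℚ.* shrink L ε
      ≡⟨ *-shrink ε 0<L ⟩
    ε ∎
    where
    open ExpBound K 0<K using (M; 0≤M; lip)
    D = ℚ.∣ seq x n ℚ.- seq y n ∣

-- At index n the defect is at most the segment from n to n + n of the majorant series of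
-- `ExpBound`, whose argument R is twice the radius r. Such segments become small because the
-- majorant sums are Cauchy.
exp-+ : ∀ x y → exp x * exp y ≈ exp (x + y)
exp-+ x y ε 0<ε =
  let (K , 0<K , N , b) = common-bound x y
      (N′ , tails)      = ExpBound.sums-cauchy K 0<K ε 0<ε
  in N ℕ.⊔ N′ , λ n Nn → bound K 0<K n (b n (l⊔ N N′ Nn))
       (tails (n ℕ.+ n) n (ℕ.≤-trans (r⊔ N N′ Nn) (ℕ.m≤m+n n n)) (r⊔ N N′ Nn))
  where
  open ℚ.≤-Reasoning
  bound : ∀ K 0<K n → ℚ.∣ seq x n ∣ ℚ.≤ K ℚ.+ 1ℚ × ℚ.∣ seq y n ∣ ℚ.≤ K ℚ.+ 1ℚ →
          ℚ.∣ ∑< (n ℕ.+ n) (ExpBound.M K 0<K) ℚ.- ∑< n (ExpBound.M K 0<K) ∣ ℚ.≤ ε →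
          ℚ.∣ expSum n (seq x n) ℚ.* expSum n (seq y n) ℚ.- expSum n (seq x n ℚ.+ seq y n) ∣ ℚ.≤ ε
  bound K 0<K n (bx , by) tail≤ε = begin
    ℚ.∣ expSum n (seq x n) ℚ.* expSum n (seq y n) ℚ.- expSum n (seq x n ℚ.+ seq y n) ∣
      ≤⟨ ∣expSum-defect∣≤ bx by n ⟩
    expSum (n ℕ.+ n) (r ℚ.+ r) ℚ.- expSum n (r ℚ.+ r)
      ≡⟨ cong (λ z → expSum (n ℕ.+ n) z ℚ.- expSum n z)
           (solve 1 (λ r → r :+ r := (con 1ℚ :+ con 1ℚ) :* r) refl r) ⟩
    expSum (n ℕ.+ n) R ℚ.- expSum n R
      ≤⟨ p≤∣p∣ (expSum (n ℕ.+ n) R ℚ.- expSum n R) ⟩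
    ℚ.∣ expSum (n ℕ.+ n) R ℚ.- expSum n R ∣
      ≤⟨ tail≤ε ⟩
    ε ∎
    where open ExpBound K 0<K using (r; R)

-- Needed where early members are exceptional: the empty partial sum of exp, and reciprocals taken
-- before the argument is bounded away from 0.
eventually-≡⇒≈ : ∀ {x y} N → (∀ n → N ℕ.≤ n → seq x n ≡ seq y n) → x ≈ y
eventually-≡⇒≈ {x} {y} N h ε 0<ε = N , λ n Nn →
  subst (ℚ._≤ ε) (sym (cong ℚ.∣_∣ (trans (cong (ℚ._- seq y n) (h n Nn)) (ℚ.+-inverseʳ (seq y n))))) (ℚ.<⇒≤ 0<ε)

exp-0 : exp 0ℝ ≈ 1ℝ
exp-0 = eventually-≡⇒≈ {exp 0ℝ} {1ℝ} 1 λ { (suc n) _ → expSum-0 n }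

inv-inverse : ∀ x 0<x → x * inv x 0<x ≈ 1ℝ
inv-inverse x 0<x@(δ , 0<δ , N , lower) = eventually-≡⇒≈ {x * inv x 0<x} {1ℝ} N λ n Nn →
  *-recip (0<⇒≢0 (ℚ.<-≤-trans 0<δ (subst (ℚ._≤ seq x n) (ℚ.+-identityˡ δ) (lower n Nn))))

-- Both bounds x and y are already known to represent z, so the distance of w from x is at most the
-- distance of y from x, which is null.
squeeze : ∀ {x y z w} → x ≈ z → y ≈ z → ∀ N →
          (∀ n → N ℕ.≤ n → seq x n ℚ.≤ seq w n × seq w n ℚ.≤ seq y n) → z ≈ w
squeeze {x} {y} {z} {w} x≈z y≈z N between = ≈-trans {z} {x} {w} (≈-sym {x} {z} x≈z) x≈w
  where
  x≈w : x ≈ w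
  x≈w ε 0<ε = let (N′ , close) = ≈-trans {y} {z} {x} y≈z (≈-sym {x} {z} x≈z) ε 0<ε in
    N ℕ.⊔ N′ , λ n Nn → let (x≤w , w≤y) = between n (l⊔ N N′ Nn) in begin
    ℚ.∣ seq x n ℚ.- seq w n ∣   ≡⟨ ∣p-q∣≡∣q-p∣ (seq x n) (seq w n) ⟩
    ℚ.∣ seq w n ℚ.- seq x n ∣   ≡⟨ ℚ.0≤p⇒∣p∣≡p (≤⇒0≤- x≤w) ⟩
    seq w n ℚ.- seq x n         ≤⟨ ℚ.+-monoˡ-≤ (ℚ.- seq x n) w≤y ⟩
    seq y n ℚ.- seq x n         ≤⟨ p≤∣p∣ _ ⟩
    ℚ.∣ seq y n ℚ.- seq x n ∣   ≤⟨ close n (r⊔ N N′ Nn) ⟩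
    ε                           ∎
    where open ℚ.≤-Reasoning

-- Null sequences and the identity exp (log q) = q

IsNull : (ℕ → ℚ) → Set
IsNull s = ∀ ε → 0ℚ ℚ.< ε → ∃ λ N → ∀ n → N ℕ.≤ n → ℚ.∣ s n ∣ ℚ.≤ ε

-- Turning error sequences into reals equal to 0 lets the limits of the bounds follow from the
-- congruence laws of the real operations.
null : ∀ s → IsNull s → ℝ
null s s→0 = mkℝ s λ ε 0<ε → let (N , small) = s→0 (ε ℚ.* ½) (0<half 0<ε) in
  N , λ m n Nm Nn → ℚ.≤-trans (ℚ.∣p-q∣≤∣p∣+∣q∣ (s m) (s n)) (≤-half (small m Nm) (small n Nn))

null≈0 : ∀ s s→0 → null s s→0 ≈ 0ℝ
null≈0 s s→0 ε 0<ε = let (N , small) = s→0 ε 0<ε in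
  N , λ n Nn → subst (λ z → ℚ.∣ z ∣ ℚ.≤ ε) (sym (ℚ.+-identityʳ (s n))) (small n Nn)

-- A power of r is the difference of two consecutive partial sums of the geometric series, which are
-- Cauchy.
^-null : ∀ {r} → 0ℚ ℚ.≤ r → r ℚ.< 1ℚ → IsNull (r ℚ-Powers.^_)
^-null {r} 0≤r r<1 ε 0<ε =
  let (N , close) = RatioTest.sums-cauchy (r ℚ-Powers.^_) (0≤^ 0≤r) r 0≤r r<1 0 (λ _ _ → ℚ.≤-refl) ε 0<ε in
  N , λ n Nn → subst (λ z → ℚ.∣ z ∣ ℚ.≤ ε)
    (solve 2 (λ a b → (a :+ b) :- a := b) refl (∑< n (r ℚ-Powers.^_)) (r ℚ-Powers.^ n))
    (close (suc n) n (ℕ.m≤n⇒m≤1+n Nn) Nn)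

-- The shift by 2 fits the rational estimates, in which an exponential sum of m + 2 terms comes with
-- the error 1/(m + 1).
1/ℕ-null : IsNull (λ n → 1/ℕ (suc (n ∸ 2)))
1/ℕ-null ε 0<ε = let (j , 1≤jε) = archimedean 1ℚ ε 0<ε in 2 ℕ.+ j , λ { (suc (suc n)) (ℕ.s≤s (ℕ.s≤s j≤n)) → begin
  ℚ.∣ 1/ℕ (suc n) ∣                     ≡⟨ ℚ.0≤p⇒∣p∣≡p (0≤κ n) ⟩
  1/ℕ (suc n)                           ≡⟨ sym (ℚ.*-identityˡ (1/ℕ (suc n))) ⟩
  1ℚ ℚ.* 1/ℕ (suc n)                    ≤⟨ *-monoʳ-≤ (1/ℕ (suc n)) (0≤κ n) (ℚ.≤-trans 1≤jε
                                             (*-monoʳ-≤ ε (ℚ.<⇒≤ 0<ε) (fromℕ-mono (ℕ.m≤n⇒m≤1+n j≤n)))) ⟩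
  (fromℕ (suc n) ℚ.* ε) ℚ.* 1/ℕ (suc n) ≡⟨ solve 3 (λ k e i → (k :* e) :* i := e :* (k :* i)) refl (fromℕ (suc n)) ε (1/ℕ (suc n)) ⟩
  ε ℚ.* (fromℕ (suc n) ℚ.* 1/ℕ (suc n)) ≡⟨ cong (ε ℚ.*_) (fromℕ*1/ℕ (suc n)) ⟩
  ε ℚ.* 1ℚ                              ≡⟨ ℚ.*-identityʳ ε ⟩
  ε                                     ∎ }
  where
  open ℚ.≤-Reasoning
  0≤κ : ∀ n → 0ℚ ℚ.≤ 1/ℕ (suc n)
  0≤κ n = ℚ.<⇒≤ (0<1/ℕ (suc n))

-- The rational estimates enclose 1 between exp ℓ (1 - u - κ) and exp (ℓ + ν) (1 - u + κ), where κ
-- is the error of the steps and ν the correction for the truncated logarithm. Both are null, so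
-- both bounds have the limit exp ℓ (1 - u).
exp-mercator : ∀ (ℓ u : ℝ) → (∀ n → seq ℓ n ≡ mercatorSum n (seq u n)) →
               ∀ {δ} → 0ℚ ℚ.< δ → ∀ N → (∀ n → N ℕ.≤ n → 0ℚ ℚ.≤ seq u n × seq u n ℚ.≤ 1ℚ ℚ.- δ) →
               exp ℓ * (1ℝ - u) ≈ 1ℝ
exp-mercator ℓ u ℓ≡ {δ} 0<δ N range =
  squeeze {exp ℓ * (1ℝ - u - κ)} {exp (ℓ + ν) * (1ℝ - u + κ)} {exp ℓ * (1ℝ - u)} {1ℝ} lower≈ upper≈ (2 ℕ.+ N) between
  where
  -- As 1 - u ≥ δ eventually, this choice gives s (1 - u) ≥ 1, the condition on the correction.
  s = recip δ
  0<s = 0<recip 0<δ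
  0≤s = ℚ.<⇒≤ 0<s
  r = 1ℚ ℚ.- δ
  r≤1 : r ℚ.≤ 1ℚ
  r≤1 = ℚ.+-monoʳ-≤ 1ℚ (ℚ.neg-antimono-≤ (ℚ.<⇒≤ 0<δ))
  r<1 : r ℚ.< 1ℚ
  r<1 = ℚ.+-monoʳ-< 1ℚ (ℚ.neg-antimono-< 0<δ)
  0≤r : 0ℚ ℚ.≤ r
  0≤r = ℚ.≤-trans (proj₁ (range N ℕ.≤-refl)) (proj₂ (range N ℕ.≤-refl))

  ν-null : IsNull (λ n → s ℚ.* seq u n ℚ-Powers.^ suc n)
  ν-null ε 0<ε = let (N′ , small) = ^-null 0≤r r<1 (shrink s ε) (0<shrink 0<s 0<ε) in N ℕ.⊔ N′ , λ n Nn → let (0≤u , u≤r) = range n (l⊔ N N′ Nn) in begin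
    ℚ.∣ s ℚ.* seq u n ℚ-Powers.^ suc n ∣   ≡⟨ ℚ.0≤p⇒∣p∣≡p (0≤* 0≤s (0≤^ 0≤u (suc n))) ⟩
    s ℚ.* seq u n ℚ-Powers.^ suc n         ≤⟨ *-monoˡ-≤ s 0≤s (^-mono 0≤u u≤r (suc n)) ⟩
    s ℚ.* r ℚ-Powers.^ suc n               ≤⟨ *-monoˡ-≤ s 0≤s (ℚ.≤-trans (p≤∣p∣ _)
                                                (small (suc n) (ℕ.m≤n⇒m≤1+n (r⊔ N N′ Nn)))) ⟩
    s ℚ.* shrink s ε                       ≡⟨ *-shrink ε 0<s ⟩
    ε                                      ∎
    where open ℚ.≤-Reasoning

  ν κ : ℝ
  ν = null _ ν-null
  κ = null _ 1/ℕ-null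

  1≤s[1-u] : ∀ n → N ℕ.≤ n → 1ℚ ℚ.≤ s ℚ.* (1ℚ ℚ.- seq u n)
  1≤s[1-u] n Nn = begin
    1ℚ                           ≡⟨ sym (*-recip (0<⇒≢0 0<δ)) ⟩
    δ ℚ.* s                      ≡⟨ solve 2 (λ d s → d :* s := s :* (con 1ℚ :- (con 1ℚ :- d))) refl δ s ⟩
    s ℚ.* (1ℚ ℚ.- r)             ≤⟨ *-monoˡ-≤ s 0≤s (ℚ.+-monoʳ-≤ 1ℚ (ℚ.neg-antimono-≤ (proj₂ (range n Nn)))) ⟩
    s ℚ.* (1ℚ ℚ.- seq u n)       ∎
    where open ℚ.≤-Reasoning

  between : ∀ n → 2 ℕ.+ N ℕ.≤ n →
            seq (exp ℓ * (1ℝ - u - κ)) n ℚ.≤ 1ℚ × 1ℚ ℚ.≤ seq (exp (ℓ + ν) * (1ℝ - u + κ)) n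
  between n@(suc (suc m)) (ℕ.s≤s (ℕ.s≤s N≤m)) =
    subst (λ z → expSum n z ℚ.* (1ℚ ℚ.- seq u n ℚ.- 1/ℕ (suc m)) ℚ.≤ 1ℚ) (sym (ℓ≡ n))
      (exp-mercator-≤ 0≤u u≤1 m) ,
    subst (λ z → 1ℚ ℚ.≤ expSum n (z ℚ.+ seq ν n) ℚ.* (1ℚ ℚ.- seq u n ℚ.+ 1/ℕ (suc m))) (sym (ℓ≡ n))
      -- The truncation is taken to be n, so that the logarithm sum is the member of `ℓ` at index n.
      (exp-mercator-≥ 0≤u u≤1 m 0≤s (1≤s[1-u] n N≤n) n)
    where
    N≤n = ℕ.m≤n⇒m≤1+n (ℕ.m≤n⇒m≤1+n N≤m)
    0≤u = proj₁ (range n N≤n)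
    u≤1 = ℚ.≤-trans (proj₂ (range n N≤n)) r≤1

  open CommutativeRing ℝ-commutativeRing using (+-identityʳ)

  +null : ∀ x {y} → y ≈ 0ℝ → x + y ≈ x
  +null x {y} y≈0 = ≈-trans {x + y} {x + 0ℝ} {x} (+-cong {x} {x} {y} {0ℝ} (≈-refl {x}) y≈0) (+-identityʳ x)

  -κ≈0 : - κ ≈ 0ℝ
  -κ≈0 = -‿cong {κ} {0ℝ} (null≈0 _ 1/ℕ-null)

  lower≈ : exp ℓ * (1ℝ - u - κ) ≈ exp ℓ * (1ℝ - u)
  lower≈ = *-cong {exp ℓ} {exp ℓ} {1ℝ - u - κ} {1ℝ - u} (≈-refl {exp ℓ}) (+null (1ℝ - u) { - κ} -κ≈0)

  upper≈ : exp (ℓ + ν) * (1ℝ - u + κ) ≈ exp ℓ * (1ℝ - u)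
  upper≈ = *-cong {exp (ℓ + ν)} {exp ℓ} {1ℝ - u + κ} {1ℝ - u}
    (exp-cong {ℓ + ν} {ℓ} (+null ℓ {ν} (null≈0 _ ν-null))) (+null (1ℝ - u) {κ} (null≈0 _ 1/ℕ-null))

-- Both exp ℓ and q are inverse to exp (- ℓ): the former by the addition theorem, the latter by
-- `exp-mercator` with u = 1 - q, since - ℓ is the Mercator series at u.
exp-log : ∀ q 0<q q<1 → exp (log q 0<q q<1) ≈ q
exp-log q 0<q@(δ , 0<δ , N₁ , lower) q<1@(δ′ , 0<δ′ , N₂ , upper) = begin
  e                        ≈⟨ ≡⇒≈ {e} {e * 1ℝ} (λ n → sym (ℚ.*-identityʳ (seq e n))) ⟩
  e * 1ℝ                   ≈⟨ *-cong {e} {e} {1ℝ} {e′ * (1ℝ - u)} (≈-refl {e}) (≈-sym {e′ * (1ℝ - u)} {1ℝ} e′[1-u]≈1) ⟩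
  e * (e′ * (1ℝ - u))      ≈⟨ ≡⇒≈ {e * (e′ * (1ℝ - u))} {(e * e′) * q} (λ n →
                                solve 3 (λ a b q → a :* (b :* (con 1ℚ :- (con 1ℚ :- q))) := (a :* b) :* q) refl
                                  (seq e n) (seq e′ n) (seq q n)) ⟩
  (e * e′) * q             ≈⟨ *-cong {e * e′} {1ℝ} {q} {q} ee′≈1 (≈-refl {q}) ⟩
  1ℝ * q                   ≈⟨ ≡⇒≈ {1ℝ * q} {q} (λ n → ℚ.*-identityˡ (seq q n)) ⟩
  q                        ∎
  where
  open ℝ-Reasoning
  ℓ = log q 0<q q<1
  e = exp ℓ
  e′ = exp (- ℓ)
  u = 1ℝ - q
  range : ∀ n → N₁ ℕ.⊔ N₂ ℕ.≤ n → 0ℚ ℚ.≤ seq u n × seq u n ℚ.≤ 1ℚ ℚ.- δ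
  range n Nn =
    ≤⇒0≤- {seq q n} {1ℚ} (ℚ.≤-trans (≤+ (ℚ.<⇒≤ 0<δ′)) (upper n (r⊔ N₁ N₂ Nn))) ,
    ℚ.+-monoʳ-≤ 1ℚ (ℚ.neg-antimono-≤ (subst (ℚ._≤ seq q n) (ℚ.+-identityˡ δ) (lower n (l⊔ N₁ N₂ Nn))))
  e′[1-u]≈1 : e′ * (1ℝ - u) ≈ 1ℝ
  e′[1-u]≈1 = exp-mercator (- ℓ) u
    (λ n → solve 1 (λ a → :- (:- a) := a) refl (mercatorSum n (seq u n))) 0<δ (N₁ ℕ.⊔ N₂) range
  ee′≈1 : e * e′ ≈ 1ℝ
  ee′≈1 = begin
    e * e′         ≈⟨ exp-+ ℓ (- ℓ) ⟩
    exp (ℓ - ℓ)    ≈⟨ exp-cong {ℓ - ℓ} {0ℝ} (≡⇒≈ {ℓ - ℓ} {0ℝ} (λ n → ℚ.+-inverseʳ (seq ℓ n))) ⟩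
    exp 0ℝ         ≈⟨ exp-0 ⟩
    1ℝ             ∎

-- Power series coefficients and binomial sums, index by index

seq-^ : ∀ x n j → seq (x ^ n) j ≡ seq x j ℚ-Powers.^ n
seq-^ x zero    j = refl
seq-^ x (suc n) j = cong (seq x j ℚ.*_) (seq-^ x n j)

seq-sum : ∀ {n} (f : Fin n → ℝ) j → seq (sum f) j ≡ ℚ-Sum.sum (λ i → seq (f i) j)
seq-sum {zero}  f j = refl
seq-sum {suc n} f j = cong (seq (f Fin.zero) j ℚ.+_) (seq-sum (λ i → f (Fin.suc i)) j)

seq-e : ∀ a n j → seq (e^[ a ]t n) j ≡ expTerm n (seq a j)
seq-e a n j = cong (ℚ._* 1/! n) (seq-^ a n j)

-- Length and `h` are arbitrary so that the induction can shift both: the coefficient of t^(k+1) at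
-- i + 1 reduces to that of t^k at i.
t^-select : ∀ {m k} h j → k ℕ.< m → ℚ-Sum.sum {m} (λ i → seq ((t^ k) (toℕ i)) j ℚ.* h (toℕ i)) ≡ h k
t^-select {suc m} {zero} h j _ = begin
  1ℚ ℚ.* h 0 ℚ.+ ℚ-Sum.sum {m} (λ i → 0ℚ ℚ.* h (suc (toℕ i)))
    ≡⟨ cong₂ ℚ._+_ (ℚ.*-identityˡ (h 0)) (trans
         (ℚ-Sum.sum-cong-≗ {m} (λ i → ℚ.*-zeroˡ (h (suc (toℕ i))))) (ℚ-Sum.sum-replicate-zero m)) ⟩
  h 0 ℚ.+ 0ℚ
    ≡⟨ ℚ.+-identityʳ (h 0) ⟩
  h 0 ∎
  where open ≡-Reasoning
t^-select {suc m} {suc k} h j (ℕ.s≤s k<m) = begin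
  0ℚ ℚ.* h 0 ℚ.+ ℚ-Sum.sum {m} (λ i → seq ((t^ k) (toℕ i)) j ℚ.* h (suc (toℕ i)))
    ≡⟨ cong₂ ℚ._+_ (ℚ.*-zeroˡ (h 0)) (t^-select (λ i → h (suc i)) j k<m) ⟩
  0ℚ ℚ.+ h (suc k)
    ≡⟨ ℚ.+-identityˡ (h (suc k)) ⟩
  h (suc k) ∎
  where open ≡-Reasoning

seq-⊛ : ∀ f g n j →
        seq ((f ⊛ g) n) j ≡ ℚ-Sum.sum {suc n} (λ i → seq (f (toℕ i)) j ℚ.* seq (g (n ∸ toℕ i)) j)
seq-⊛ f g n j = seq-sum {suc n} (λ i → f (toℕ i) * g (n ∸ toℕ i)) j

seq-t^⊛e : ∀ {k n} b j → k ℕ.≤ n → seq ((t^ k ⊛ e^[ b ]t) n) j ≡ expTerm (n ∸ k) (seq b j)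
seq-t^⊛e {k} {n} b j k≤n = trans (seq-⊛ (t^ k) e^[ b ]t n j)
  (trans (t^-select {suc n} {k} (λ i → seq (e^[ b ]t (n ∸ i)) j) j (ℕ.s≤s k≤n)) (seq-e b (n ∸ k) j))

-- The terms of (a + b)^n, with the binomial coefficient spread over factorials as in the generating
-- function. The predicate covers the polynomials as well as the summands of the operator.
IsBinomial : ∀ n (a b : ℝ) (f : Fin (suc n) → ℝ) → Set
IsBinomial n a b f =
  ∀ k j → seq (f k) j ≡ fromℕ (n !) ℚ.* (expTerm (toℕ k) (seq a j) ℚ.* expTerm (n ∸ toℕ k) (seq b j))

binomial-sum : ∀ n a b (f : Fin (suc n) → ℝ) → IsBinomial n a b f → sum f ≈ (a + b) ^ n
binomial-sum n a b f f≡ = ≡⇒≈ {sum f} {(a + b) ^ n} λ j →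
  let p = seq a j
      r = seq b j in begin
  seq (sum f) j
    ≡⟨ seq-sum f j ⟩
  ℚ-Sum.sum {suc n} (λ k → seq (f k) j)
    ≡⟨ ℚ-Sum.sum-cong-≗ {suc n} (λ k → f≡ k j) ⟩
  ℚ-Sum.sum {suc n} (λ k → fromℕ (n !) ℚ.* (expTerm (toℕ k) p ℚ.* expTerm (n ∸ toℕ k) r))
    ≡⟨ sym (ℚ-Sum.*-distribˡ-sum {suc n} (fromℕ (n !)) (λ k → expTerm (toℕ k) p ℚ.* expTerm (n ∸ toℕ k) r)) ⟩
  fromℕ (n !) ℚ.* ℚ-Sum.sum {suc n} (λ k → expTerm (toℕ k) p ℚ.* expTerm (n ∸ toℕ k) r)
    ≡⟨ cong (fromℕ (n !) ℚ.*_) (expTerm-+ p r n) ⟩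
  fromℕ (n !) ℚ.* ((p ℚ.+ r) ℚ-Powers.^ n ℚ.* 1/! n)
    ≡⟨ solve 3 (λ f p i → f :* (p :* i) := (f :* i) :* p) refl (fromℕ (n !)) ((p ℚ.+ r) ℚ-Powers.^ n) (1/! n) ⟩
  (fromℕ (n !) ℚ.* 1/! n) ℚ.* (p ℚ.+ r) ℚ-Powers.^ n
    ≡⟨ cong (ℚ._* (p ℚ.+ r) ℚ-Powers.^ n) (fromℕ!*1/! n) ⟩
  1ℚ ℚ.* (p ℚ.+ r) ℚ-Powers.^ n
    ≡⟨ ℚ.*-identityˡ ((p ℚ.+ r) ℚ-Powers.^ n) ⟩
  (p ℚ.+ r) ℚ-Powers.^ n
    ≡⟨ sym (seq-^ (a + b) n j) ⟩
  seq ((a + b) ^ n) j ∎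
  where open ≡-Reasoning

-- The base y is implicit so that it is found by unification: comparing two
-- presentations of a real under _^ n would compare their Cauchy moduli.
sum≈^ : ∀ n a b (f : Fin (suc n) → ℝ) {y} → IsBinomial n a b f → a + b ≈ y → sum f ≈ y ^ n
sum≈^ n a b f {y} f≡ a+b≈y = ≈-trans {sum f} {(a + b) ^ n} {y ^ n}
  (binomial-sum n a b f f≡) (ℝ-Exp.^-congˡ n {a + b} {y} a+b≈y)

^≈sum : ∀ n a b (f : Fin (suc n) → ℝ) {y} → IsBinomial n a b f → a + b ≈ y → y ^ n ≈ sum f
^≈sum n a b f {y} f≡ a+b≈y = ≈-sym {sum f} {y ^ n} (sum≈^ n a b f {y} f≡ a+b≈y)

-- The modified q-Bernstein polynomials

module _ (q : ℝ) (0<q : 0ℝ < q) (q<1 : q < 1ℝ) where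

  open QBernstein q 0<q q<1

  -- The prefactor [x]^k / k! is itself an exponential coefficient, and multiplication by t^k
  -- selects the coefficient n - k of the other series.
  seq-B : ∀ {k n} x j → k ℕ.≤ n →
          seq (B k n x) j ≡ fromℕ (n !) ℚ.* (expTerm k (seq [ x ]q j) ℚ.* expTerm (n ∸ k) (seq [ 1ℝ - x ]q j))
  seq-B {k} {n} x j k≤n =
    cong₂ (λ y z → fromℕ (n !) ℚ.* (y ℚ.* z)) (seq-e [ x ]q k j) (seq-t^⊛e [ 1ℝ - x ]q j k≤n)

  -- The reals 1 - (1 - x) and x agree at every index, so the q-numbers agree exactly and not only
  -- up to a null sequence.
  seq-[1-[1-x]] : ∀ x j → seq [ 1ℝ - (1ℝ - x) ]q j ≡ seq [ x ]q j
  seq-[1-[1-x]] x j = cong (λ z → (1ℚ ℚ.- expSum j (z ℚ.* seq (log q 0<q q<1) j)) ℚ.* seq (inv (1ℝ - q) 0<1-q) j)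
    (solve 1 (λ x → con 1ℚ :- (con 1ℚ :- x) := x) refl (seq x j))

  B-symmetric : ∀ n x k → k ℕ.≤ n → B (n ∸ k) n (1ℝ - x) ≈ B k n x
  B-symmetric n x k k≤n = ≡⇒≈ {B (n ∸ k) n (1ℝ - x)} {B k n x} λ j →
    trans (seq-B {n ∸ k} {n} (1ℝ - x) j (ℕ.m∸n≤m n k))
      (trans (swap (seq [ x ]q j) (seq [ 1ℝ - x ]q j) (seq [ 1ℝ - (1ℝ - x) ]q j) (seq-[1-[1-x]] x j))
        (sym (seq-B {k} {n} x j k≤n)))
    where
    swap : ∀ a b a′ → a′ ≡ a →
           fromℕ (n !) ℚ.* (expTerm (n ∸ k) b ℚ.* expTerm (n ∸ (n ∸ k)) a′) ≡
           fromℕ (n !) ℚ.* (expTerm k a ℚ.* expTerm (n ∸ k) b)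
    swap a b _ refl = cong (fromℕ (n !) ℚ.*_) (trans
      (cong (λ i → expTerm (n ∸ k) b ℚ.* expTerm i a) (ℕ.m∸[m∸n]≡n k≤n))
      (ℚ.*-comm (expTerm (n ∸ k) b) (expTerm k a)))

  B-binomial : ∀ n x → IsBinomial n [ x ]q [ 1ℝ - x ]q (λ k → B (toℕ k) n x)
  B-binomial n x k j = seq-B {toℕ k} {n} x j (Fin.toℕ≤pred[n] k)

  operator-binomial : ∀ n x → IsBinomial n [ x ]q [ 1ℝ - x ]q (λ k → fun one (node n k) * B (toℕ k) n x)
  operator-binomial n x k j = trans (ℚ.*-identityˡ (seq (B (toℕ k) n x) j)) (B-binomial n x k j)

  rpow-complement : ∀ x → rpow q 0<q q<1 x * rpow q 0<q q<1 (1ℝ - x) ≈ q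
  rpow-complement x = begin
    exp (x * ℓ) * exp ((1ℝ - x) * ℓ)    ≈⟨ exp-+ (x * ℓ) ((1ℝ - x) * ℓ) ⟩
    exp (x * ℓ + (1ℝ - x) * ℓ)          ≈⟨ exp-cong {x * ℓ + (1ℝ - x) * ℓ} {ℓ} (≡⇒≈ {x * ℓ + (1ℝ - x) * ℓ} {ℓ}
                                             (λ n → solve 2 (λ x l → x :* l :+ (con 1ℚ :- x) :* l := l) refl (seq x n) (seq ℓ n))) ⟩
    exp ℓ                               ≈⟨ exp-log q 0<q q<1 ⟩
    q                                   ∎
    where
    open ℝ-Reasoning
    ℓ = log q 0<q q<1

  -- With u = q^x and v = q^(1-x), (1 - u) + (1 - v) = (1 - u v) + (1 - u) (1 - v). Since u v = q,
  -- division by 1 - q turns the first summand into 1.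
  [x]+[1-x] : ∀ x → [ x ]q + [ 1ℝ - x ]q ≈ 1ℝ + [ x ]q * [ 1ℝ - x ]q * (1ℝ - q)
  [x]+[1-x] x = begin
    (1ℝ - u) * i + (1ℝ - v) * i
      ≈⟨ ≡⇒≈ {(1ℝ - u) * i + (1ℝ - v) * i} {(1ℝ - u * v) * i + w * 1ℝ} (λ n → solve 3 (λ u v i →
           (con 1ℚ :- u) :* i :+ (con 1ℚ :- v) :* i :=
           (con 1ℚ :- u :* v) :* i :+ ((con 1ℚ :- u) :* (con 1ℚ :- v) :* i) :* con 1ℚ) refl (seq u n) (seq v n) (seq i n)) ⟩
    (1ℝ - u * v) * i + w * 1ℝ
      -- Writing the factor `1ℝ` as (1 - q) i supplies the second reciprocal needed for [x] [1-x]
      -- together with the factor 1 - q.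
      ≈⟨ +-cong {(1ℝ - u * v) * i} {(1ℝ - q) * i} {w * 1ℝ} {w * ((1ℝ - q) * i)}
           (*-cong {1ℝ - u * v} {1ℝ - q} {i} {i}
             (+-cong {1ℝ} {1ℝ} { - (u * v)} { - q} (≈-refl {1ℝ}) (-‿cong {u * v} {q} (rpow-complement x))) (≈-refl {i}))
           (*-cong {w} {w} {1ℝ} {(1ℝ - q) * i} (≈-refl {w}) (≈-sym {(1ℝ - q) * i} {1ℝ} [1-q]i≈1)) ⟩
    (1ℝ - q) * i + w * ((1ℝ - q) * i)
      ≈⟨ +-cong {(1ℝ - q) * i} {1ℝ} {w * ((1ℝ - q) * i)} {rest} [1-q]i≈1
           (≡⇒≈ {w * ((1ℝ - q) * i)} {rest} (λ n → solve 4 (λ u v i q →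
             ((con 1ℚ :- u) :* (con 1ℚ :- v) :* i) :* ((con 1ℚ :- q) :* i) :=
             (con 1ℚ :- u) :* i :* ((con 1ℚ :- v) :* i) :* (con 1ℚ :- q)) refl (seq u n) (seq v n) (seq i n) (seq q n))) ⟩
    1ℝ + rest ∎
    where
    open ℝ-Reasoning
    u = rpow q 0<q q<1 x
    v = rpow q 0<q q<1 (1ℝ - x)
    i = inv (1ℝ - q) 0<1-q
    w = (1ℝ - u) * (1ℝ - v) * i
    rest = [ x ]q * [ 1ℝ - x ]q * (1ℝ - q)
    [1-q]i≈1 = inv-inverse (1ℝ - q) 0<1-q

theorem3 : (q : ℝ) (0<q : 0ℝ < q) (q<1 : q < 1ℝ) (n : ℕ) (x : ℝ) → 0ℝ ≤ x → x ≤ 1ℝ →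
    let open QBernstein q 0<q q<1 in
    ((k : ℕ) → k ℕ.≤ n → B (n ∸ k) n (1ℝ - x) ≈ B k n x)
    × (sum {suc n} (λ k → B (toℕ k) n x) ≈ (1ℝ + [ x ]q * [ 1ℝ - x ]q * (1ℝ - q)) ^ n)
    × ((1ℝ + [ x ]q * [ 1ℝ - x ]q * (1ℝ - q)) ^ n ≈ operator n one x)
theorem3 q 0<q q<1 n x _ _ =
  B-symmetric q 0<q q<1 n x ,
  sum≈^ n [x] [1-x] (λ k → B (toℕ k) n x) (B-binomial q 0<q q<1 n x) ([x]+[1-x] q 0<q q<1 x) ,
  ^≈sum n [x] [1-x] (λ k → fun one (node n k) * B (toℕ k) n x) (operator-binomial q 0<q q<1 n x) ([x]+[1-x] q 0<q q<1 x)
  where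
  open QBernstein q 0<q q<1
  [x] = [ x ]q
  [1-x] = [ 1ℝ - x ]q
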